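{- Let $n\ge1$ and let $\mathcal{F}\subseteq 2^{[n]}$ be a family of subsets of $[n]=\{1,\dots,n\}$ which is union-closed (i.e. $S\cup T\in\mathcal F$ whenever $S,T\in\mathcal F$) and which contains at least one nonempty set. Then there exists $i\in[n]$ such that $i$ belongs to at least a $\frac{3-\sqrt5}{2}$ fraction of the sets in $\mathcal F$, i.e. $|\{S\in\mathcal F: i\in S\}|\ge \frac{3-\sqrt5}{2}|\mathcal F|$. -}

module Defs where

open import Data.Nat using (ℕ; _*_; _∸_; _^_; _≤_)
open import Data.Fin using (Fin)
open import Data.Fin.Subset using (Subset; _∈_; _∪_)
open import Data.Fin.Subset.Properties using (_∈?_)
open import Data.List using (List; length; filter)
open import Data.List.Membership.Propositional renaming (_∈_ to _∈ₗ_)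

-- A family of subsets of [n] = Fin n, given as a duplicate-free list
-- (duplicate-freeness is imposed as a hypothesis in the statement).
Family : ℕ → Set
Family n = List (Subset n)

UnionClosed : ∀ {n} → Family n → Set
UnionClosed F = ∀ S T → S ∈ₗ F → T ∈ₗ F → (S ∪ T) ∈ₗ F

count : ∀ {n} → Fin n → Family n → ℕ
count i F = length (filter (i ∈?_) F)

-- a ≥ ((3 - √5)/2) * b, for natural numbers a, b, stated exactly:
--   2a ≥ (3 - √5) b  ⇔  √5 b ≥ 3b - 2a.
-- If 3b ≤ 2a this holds trivially (and 3b ∸ 2a = 0); otherwise both sides
-- are nonnegative and it is equivalent to (3b - 2a)^2 ≤ 5 b^2.
AtLeastGoldenFrac : ℕ → ℕ → Set
AtLeastGoldenFrac a b = (3 * b ∸ 2 * a) ^ 2 ≤ 5 * b ^ 2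

{-# OPTIONS --safe #-}
module Submission where

-- The entropy method. Let A, B be independent and uniform in F. Since A ∪ B lies in F, its entropy is at most log |F|,
-- the entropy of A. On the other hand, with h the binary entropy and φ the golden ratio,
--   h (x y) ≥ (φ / 2) (x h (y) + y h (x)),
-- so by the chain rule the entropy of A ∪ B is at least φ Σᵢ Pr[i ∉ A] · (entropy of the i-th coordinate of A given the
-- previous ones), which exceeds the entropy of A if Pr[i ∉ A] > 1 / φ for every i. The inequality for h is the combination of
--   h (x y) / (x y) ≥ (h (x²) / x² + h (y²) / y²) / 2   and   h (x²) ≥ φ x h (x),
-- and both follow from one rational bound, log t ≤ (t - 1) (t + 5) / (4 t + 2). All quantities are kept homogeneous, so that
-- logarithms of natural numbers with integer coefficients are the only real numbers that occur.

open import Defs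
open import Data.Nat using (ℕ; _≤_)
open import Data.Fin using (Fin)
open import Data.Fin.Subset using (Subset; Nonempty)
open import Data.Product using (∃; ∃-syntax; _×_)
open import Data.List.Relation.Unary.Unique.Propositional using (Unique)
open import Data.List.Membership.Propositional using (_∈_)
open import Data.List using (length)

open import Data.Nat as ℕ using (zero; suc; s≤s; z≤n; NonZero)
import Data.Nat.Properties as ℕ
import Data.Nat.Tactic.RingSolver as ℕ-Ring
open import Data.Integer as ℤ using (ℤ; +_; -[1+_]; 0ℤ; 1ℤ; _+_; _*_; _-_; -_; _^_; +≤+; +<+)
open import Data.Integer.Properties using
  (≤-refl; ≤-reflexive; +-mono-≤; +-mono-<-≤; +-mono-≤-<; pos-*; *-cancelˡ-≤-pos; i≤j⇒0≤j-i)
open import Data.Integer.Tactic.RingSolver using (solve-∀)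
open import Data.Fin using (zero; suc)
open import Data.Fin.Properties using (any?)
open import Data.Fin.Subset using (_∪_; inside; outside) renaming (_∈_ to _∈ˢ_; _∉_ to _∉ˢ_)
open import Data.Fin.Subset.Properties using (_∈?_)
open import Data.Vec using (Vec; []; _∷_; _∷ʳ_; map; zipWith; here; there)
open import Data.Vec.Relation.Unary.All using (All; []; _∷_; all?)
open import Data.List using ([]; _∷_)
import Data.List.Relation.Unary.All as ListAll
open import Data.List.Relation.Unary.AllPairs using (_∷_)
open import Data.List.Relation.Unary.Any using (here; there)
open import Data.Product using (∃₂; _,_; proj₁; proj₂)
open import Data.Sum using (inj₁; inj₂)
open import Data.Empty using (⊥-elim)
open import Function using (_∘_)
open import Relation.Nullary using (¬_; Dec; yes; no)
open import Relation.Nullary.Decidable using (True; toWitness)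
open import Relation.Binary.PropositionalEquality using (_≡_; _≢_; refl; sym; trans; cong; cong₂; subst)

-- Two obstacles shape the proof. The inequality h (x²) ≥ φ x h (x) is an equality at x = 1 / φ,
-- since x² = 1 - x there, and the difference has a double zero. Any estimate of logarithms must be
-- exact to second order at that point, so the logarithms are regrouped until each one either
-- vanishes there or has a coefficient with a double zero. The other obstacle is that φ is
-- irrational while coefficients are integers. With N = |F| and X the least number of sets that
-- avoid an element, φ is replaced by a fraction P / Q with N / X < P / Q < φ. Since N² < N X + X²
-- is a strict inequality of integers, a positive multiple of log N remains at the end, and this
-- contradicts an inequality that holds only up to lower order. The rational bound for log is usable
-- because its derivative differs from 1 / t by (t - 1)³ / (t (2 t + 1)²); summing log t ≤ t - 1
-- over small steps then proves it without calculus. The first of the two inequalities for h is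
-- midpoint concavity of h (t) / t as a function of log t.

0≤+ : ∀ n → 0ℤ ℤ.≤ + n
0≤+ n = +≤+ z≤n

0≤-+ : ∀ {x y} → 0ℤ ℤ.≤ x → 0ℤ ℤ.≤ y → 0ℤ ℤ.≤ x + y
0≤-+ = +-mono-≤

0≤-* : ∀ {x y} → 0ℤ ℤ.≤ x → 0ℤ ℤ.≤ y → 0ℤ ℤ.≤ x * y
0≤-* {+ m} {+ n} _ _ = subst (0ℤ ℤ.≤_) (pos-* m n) (0≤+ _)

0≤-square : ∀ x → 0ℤ ℤ.≤ x * x
0≤-square (+ n)    = 0≤-* (0≤+ n) (0≤+ n)
0≤-square -[1+ n ] = 0≤+ _

0≤-cancel : ∀ n {x} → 0ℤ ℤ.≤ + suc n * x → 0ℤ ℤ.≤ x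
0≤-cancel n {x} h = *-cancelˡ-≤-pos 0ℤ x (+ suc n) (subst (ℤ._≤ + suc n * x) (lem (+ suc n)) h)
  where
  lem : ∀ k → 0ℤ ≡ k * 0ℤ
  lem = solve-∀

-- Asymptotic inequalities between integer sequences

-- A sequence f stands for the real number lim f M / M, and Pos f says that this number is nonnegative:
-- f M ≥ - ε M - C for every ε = 1 / k.
record Pos (f : ℕ → ℤ) : Set where
  constructor pos
  field bound : ∀ k → ∃ λ C → ∀ M → 0ℤ ℤ.≤ + k * f M + + (M ℕ.+ C)

open Pos

𝟙 : ℕ → ℤ
𝟙 M = + suc M

Pos-cong : ∀ {f g} → (∀ M → f M ≡ g M) → Pos f → Pos g
Pos-cong f≡g (pos b) .bound k = proj₁ (b k) , λ M →
  subst (λ x → 0ℤ ℤ.≤ + k * x + + (M ℕ.+ proj₁ (b k))) (f≡g M) (proj₂ (b k) M)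

Pos-bounded : ∀ {f} C → (∀ M → 0ℤ ℤ.≤ f M + + C) → Pos f
Pos-bounded {f} C h .bound k = k ℕ.* C , λ M →
  subst (0ℤ ℤ.≤_) (trans (lem (+ k) (f M) (+ C) (+ M)) (cong (λ x → + k * f M + (+ M + x)) (sym (pos-* k C))))
    (0≤-+ (0≤-* (0≤+ k) (h M)) (0≤+ M))
  where
  lem : ∀ k f c m → k * (f + c) + m ≡ k * f + (m + k * c)
  lem = solve-∀

Pos-nonneg : ∀ {f} → (∀ M → 0ℤ ℤ.≤ f M) → Pos f
Pos-nonneg h = Pos-bounded 0 λ M → 0≤-+ (h M) ≤-refl

infixl 6 _⊕_
_⊕_ : ∀ {f g} → Pos f → Pos g → Pos (λ M → f M + g M)
_⊕_ {f} {g} (pos b) (pos c) .bound k = C , λ M →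
  0≤-cancel 1 (subst (0ℤ ℤ.≤_) (lem (+ k) (f M) (g M) (+ M) (+ proj₁ (b (k ℕ.+ k))) (+ proj₁ (c (k ℕ.+ k))))
    (0≤-+ (0≤-+ (proj₂ (b (k ℕ.+ k)) M) (proj₂ (c (k ℕ.+ k)) M)) (0≤+ C)))
  where
  C = proj₁ (b (k ℕ.+ k)) ℕ.+ proj₁ (c (k ℕ.+ k))
  lem : ∀ k f g m c d → (((k + k) * f + (m + c)) + ((k + k) * g + (m + d))) + (c + d) ≡ + 2 * (k * (f + g) + (m + (c + d)))
  lem = solve-∀

infixr 7 _⊛_
_⊛_ : ∀ {z f} → 0ℤ ℤ.≤ z → Pos f → Pos (λ M → z * f M)
_⊛_ {+ n} {f} _ (pos b) .bound k = proj₁ (b (k ℕ.* n)) , λ M →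
  subst (λ x → 0ℤ ℤ.≤ x + + (M ℕ.+ proj₁ (b (k ℕ.* n))))
    (trans (cong (_* f M) (pos-* k n)) (lem (+ k) (+ n) (f M))) (proj₂ (b (k ℕ.* n)) M)
  where
  lem : ∀ k n f → k * n * f ≡ k * (n * f)
  lem = solve-∀

Pos-cancel : ∀ n {f} → Pos (λ M → + suc n * f M) → Pos f
Pos-cancel n {f} (pos b) .bound k = proj₁ (b k) , λ M →
  0≤-cancel n (subst (0ℤ ℤ.≤_) (lem (+ k) (+ n) (f M) (+ (M ℕ.+ proj₁ (b k))))
    (0≤-+ (proj₂ (b k) M) (0≤-* (0≤+ n) (0≤+ _))))
  where
  lem : ∀ k n f c → (k * ((1ℤ + n) * f) + c) + n * c ≡ (1ℤ + n) * (k * f + c)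
  lem = solve-∀

-- Dividing by k + 1 and letting k grow removes an error `c` that stays fixed while the main term is
-- scaled up.
Pos-limit : ∀ c {f} → (∀ k → Pos (λ M → + suc k * f M + + c * 𝟙 M)) → Pos f
Pos-limit c {f} h .bound zero = 0 , λ M → 0≤-+ {x = 0ℤ * f M} (≤-reflexive (lem (f M))) (0≤+ _)
  where
  lem : ∀ x → 0ℤ ≡ 0ℤ * x
  lem = solve-∀
Pos-limit c {f} h .bound (suc k) = C ℕ.+ 1 , λ M →
  0≤-cancel c (subst (0ℤ ℤ.≤_)
    (trans (cong (λ x → 1ℤ * (x * f M + + c * (1ℤ + + M)) + (+ M + + C) + (+ c * + C + 1ℤ)) (pos-* (suc k) (suc c)))
      (lem (+ k) (+ c) (f M) (+ M) (+ C)))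
    (0≤-+ (proj₂ (h K .bound 1) M) (0≤-+ (0≤-* (0≤+ c) (0≤+ C)) (0≤+ 1))))
  where
  K = c ℕ.+ k ℕ.* suc c
  C = proj₁ (h K .bound 1)
  lem : ∀ k c f m d → 1ℤ * ((1ℤ + k) * (1ℤ + c) * f + c * (1ℤ + m)) + (m + d) + (c * d + 1ℤ)
    ≡ (1ℤ + c) * ((1ℤ + k) * f + (m + (d + 1ℤ)))
  lem = solve-∀

¬Pos-𝟙 : ¬ Pos (λ M → - 𝟙 M)
-- With ε = 1 / 2 and M = C the bound would read 0 ≤ - 2.
¬Pos-𝟙 (pos b) with b 2
... | C , h with subst (0ℤ ℤ.≤_) (lem (+ C)) (h C)
  where
  lem : ∀ c → + 2 * (- (1ℤ + c)) + (c + c) ≡ - + 2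
  lem = solve-∀
... | ()

-- Bernoulli's inequality and integer logarithms

bernoulli : ∀ m d → (m ℕ.+ d) ℕ.* m ℕ.^ d ℕ.≤ m ℕ.* suc m ℕ.^ d
bernoulli m zero = ℕ.*-monoˡ-≤ 1 (ℕ.≤-reflexive (ℕ.+-identityʳ m))
bernoulli m (suc d) = begin
  (m ℕ.+ suc d) ℕ.* (m ℕ.* m ℕ.^ d)          ≤⟨ ℕ.m≤m+n _ (d ℕ.* m ℕ.^ d) ⟩
  (m ℕ.+ suc d) ℕ.* (m ℕ.* m ℕ.^ d) ℕ.+ d ℕ.* m ℕ.^ d ≡⟨ lem m d (m ℕ.^ d) ⟩
  suc m ℕ.* ((m ℕ.+ d) ℕ.* m ℕ.^ d)          ≤⟨ ℕ.*-monoʳ-≤ (suc m) (bernoulli m d) ⟩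
  suc m ℕ.* (m ℕ.* suc m ℕ.^ d)              ≡⟨ lem′ m (suc m ℕ.^ d) ⟩
  m ℕ.* (suc m ℕ.* suc m ℕ.^ d)              ∎
  where
  open ℕ.≤-Reasoning
  lem : ∀ m d x → (m ℕ.+ suc d) ℕ.* (m ℕ.* x) ℕ.+ d ℕ.* x ≡ suc m ℕ.* ((m ℕ.+ d) ℕ.* x)
  lem = ℕ-Ring.solve-∀
  lem′ : ∀ m x → suc m ℕ.* (m ℕ.* x) ≡ m ℕ.* (suc m ℕ.* x)
  lem′ = ℕ-Ring.solve-∀

-- Bernoulli's inequality for the base 1 - 1 / (m + 1), cleared of denominators; `bernoulli` has the
-- base 1 + 1 / m.
bernoulli′ : ∀ m d → suc m ℕ.^ suc d ℕ.≤ m ℕ.^ d ℕ.* suc m ℕ.+ d ℕ.* suc m ℕ.^ d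
bernoulli′ m zero = ℕ.≤-reflexive (lem m)
  where
  lem : ∀ m → suc m ℕ.* 1 ≡ 1 ℕ.* suc m ℕ.+ 0
  lem = ℕ-Ring.solve-∀
bernoulli′ m (suc d) = begin
  suc m ℕ.* suc m ℕ.^ suc d ≤⟨ ℕ.*-monoʳ-≤ (suc m) (bernoulli′ m d) ⟩
  suc m ℕ.* (m ℕ.^ d ℕ.* suc m ℕ.+ d ℕ.* suc m ℕ.^ d) ≡⟨ lem m d (m ℕ.^ d) (suc m ℕ.^ d) ⟩
  m ℕ.* m ℕ.^ d ℕ.* suc m ℕ.+ m ℕ.^ d ℕ.* suc m ℕ.+ d ℕ.* (suc m ℕ.* suc m ℕ.^ d)
    ≤⟨ ℕ.+-monoˡ-≤ (d ℕ.* (suc m ℕ.* suc m ℕ.^ d)) (ℕ.+-monoʳ-≤ (m ℕ.* m ℕ.^ d ℕ.* suc m) (ℕ.≤-trans (ℕ.*-monoˡ-≤ (suc m) (ℕ.^-monoˡ-≤ d (ℕ.n≤1+n m))) (ℕ.≤-reflexive (ℕ.*-comm (suc m ℕ.^ d) (suc m))))) ⟩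
  m ℕ.* m ℕ.^ d ℕ.* suc m ℕ.+ suc m ℕ.* suc m ℕ.^ d ℕ.+ d ℕ.* (suc m ℕ.* suc m ℕ.^ d) ≡⟨ ℕ.+-assoc (m ℕ.* m ℕ.^ d ℕ.* suc m) _ _ ⟩
  m ℕ.* m ℕ.^ d ℕ.* suc m ℕ.+ suc d ℕ.* (suc m ℕ.* suc m ℕ.^ d) ∎
  where
  open ℕ.≤-Reasoning
  lem : ∀ m d x y → suc m ℕ.* (x ℕ.* suc m ℕ.+ d ℕ.* y) ≡ m ℕ.* x ℕ.* suc m ℕ.+ x ℕ.* suc m ℕ.+ d ℕ.* (suc m ℕ.* y)
  lem = ℕ-Ring.solve-∀

-- (1 + 1/m) ^ j ≤ n
Below : ℕ → ℕ → ℕ → Set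
Below m n j = suc m ℕ.^ j ℕ.≤ n ℕ.* m ℕ.^ j

Below-< : ∀ m n i k .{{_ : NonZero n}} → Below m n i → ¬ Below m n k → i ℕ.< k
Below-< m n i k p ¬q with i ℕ.<? k
... | yes i<k = i<k
... | no i≮k with ℕ.m≤n⇒∃[o]m+o≡n (ℕ.≮⇒≥ i≮k)
...   | d , refl = ⊥-elim (ℕ.<-irrefl refl (ℕ.<-≤-trans lt p))
  where
  open ℕ.≤-Reasoning
  lem : ∀ n x y → n ℕ.* (x ℕ.* y) ≡ n ℕ.* x ℕ.* y
  lem = ℕ-Ring.solve-∀
  lt : n ℕ.* m ℕ.^ (k ℕ.+ d) ℕ.< suc m ℕ.^ (k ℕ.+ d)
  lt = begin-strict
    n ℕ.* m ℕ.^ (k ℕ.+ d)        ≡⟨ cong (n ℕ.*_) (ℕ.^-distribˡ-+-* m k d) ⟩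
    n ℕ.* (m ℕ.^ k ℕ.* m ℕ.^ d) ≡⟨ lem n (m ℕ.^ k) (m ℕ.^ d) ⟩
    n ℕ.* m ℕ.^ k ℕ.* m ℕ.^ d   ≤⟨ ℕ.*-monoʳ-≤ (n ℕ.* m ℕ.^ k) (ℕ.^-monoˡ-≤ d (ℕ.n≤1+n m)) ⟩
    n ℕ.* m ℕ.^ k ℕ.* suc m ℕ.^ d <⟨ ℕ.*-monoˡ-< (suc m ℕ.^ d) {{ℕ.m^n≢0 (suc m) d}} (ℕ.≰⇒> ¬q) ⟩
    suc m ℕ.^ k ℕ.* suc m ℕ.^ d ≡⟨ ℕ.^-distribˡ-+-* (suc m) k d ⟨
    suc m ℕ.^ (k ℕ.+ d) ∎

last : ∀ {P : ℕ → Set} → (∀ j → Dec (P j)) → ∀ u → P 0 → ¬ P u → ∃ λ j → P j × ¬ P (suc j)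
last P? zero p ¬p = ⊥-elim (¬p p)
last P? (suc u) p ¬p with P? u
... | yes q = u , q , ¬p
... | no ¬q = last P? u p ¬q

-- Bernoulli gives (1 + 1 / (m + 1)) ^ (n (m + 1)) ≥ 1 + n > n, which bounds the search for the
-- logarithm.
Below-upper : ∀ m n → ¬ Below (suc m) n (n ℕ.* suc m)
Below-upper m n p = ℕ.<-irrefl refl (ℕ.<-≤-trans (ℕ.*-cancelˡ-< (suc m) _ _ lt) p)
  where
  open ℕ.≤-Reasoning
  x = suc m ℕ.^ (n ℕ.* suc m)
  lem : ∀ m n x → (suc m ℕ.+ n ℕ.* suc m) ℕ.* x ≡ suc m ℕ.* (n ℕ.* x) ℕ.+ suc m ℕ.* x
  lem = ℕ-Ring.solve-∀
  lt : suc m ℕ.* (n ℕ.* x) ℕ.< suc m ℕ.* suc (suc m) ℕ.^ (n ℕ.* suc m)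
  lt = begin-strict
    suc m ℕ.* (n ℕ.* x) <⟨ ℕ.m<m+n _ (ℕ.>-nonZero⁻¹ _ {{ℕ.m*n≢0 (suc m) x {{_}} {{ℕ.m^n≢0 (suc m) (n ℕ.* suc m)}}}}) ⟩
    suc m ℕ.* (n ℕ.* x) ℕ.+ suc m ℕ.* x ≡⟨ lem m n x ⟨
    (suc m ℕ.+ n ℕ.* suc m) ℕ.* x ≤⟨ bernoulli (suc m) (n ℕ.* suc m) ⟩
    suc m ℕ.* suc (suc m) ℕ.^ (n ℕ.* suc m) ∎

abstract
  -- Logarithms to the base 1 + 1/(M + 1) have the right scale: log n M / M tends to the natural logarithm of n.
  -- ⌊ log n / log (1 + 1/(M + 1)) ⌋, and 0 for n = 0
  log : ℕ → ℕ → ℕ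
  log zero M = 0
  log n@(suc _) M = proj₁ (last {Below (suc M) n} (λ j → _ ℕ.≤? _) (n ℕ.* suc M) (s≤s z≤n) (Below-upper M n))

  log-0 : ∀ M → log 0 M ≡ 0
  log-0 M = refl

  log-below : ∀ n M .{{_ : NonZero n}} → Below (suc M) n (log n M)
  log-below n@(suc _) M = proj₁ (proj₂ (last {Below (suc M) n} (λ j → _ ℕ.≤? _) (n ℕ.* suc M) (s≤s z≤n) (Below-upper M n)))

  log-above : ∀ n M .{{_ : NonZero n}} → ¬ Below (suc M) n (suc (log n M))
  log-above n@(suc _) M = proj₂ (proj₂ (last {Below (suc M) n} (λ j → _ ℕ.≤? _) (n ℕ.* suc M) (s≤s z≤n) (Below-upper M n)))

ln : ℕ → ℕ → ℤ
ln n M = + log n M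

ln-0 : ∀ M → ln 0 M ≡ 0ℤ
ln-0 M = cong +_ (log-0 M)

ln-1 : ∀ M → ln 1 M ≡ 0ℤ
ln-1 M = cong +_ (ℕ.n<1⇒n≡0 (Below-< (suc M) 1 _ 1 (log-below 1 M) λ p → ℕ.<-irrefl refl (lem p)))
  where
  lem : Below (suc M) 1 1 → suc M ℕ.< suc M
  lem p = ℕ.≤-trans (ℕ.≤-reflexive (sym (ℕ.*-identityʳ _))) (ℕ.≤-trans p (ℕ.≤-reflexive (trans (ℕ.*-identityˡ _) (ℕ.*-identityʳ _))))

Below-* : ∀ m p q i j → Below m p i → Below m q j → Below m (p ℕ.* q) (i ℕ.+ j)
Below-* m p q i j a b = begin
  suc m ℕ.^ (i ℕ.+ j) ≡⟨ ℕ.^-distribˡ-+-* (suc m) i j ⟩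
  suc m ℕ.^ i ℕ.* suc m ℕ.^ j ≤⟨ ℕ.*-mono-≤ a b ⟩
  p ℕ.* m ℕ.^ i ℕ.* (q ℕ.* m ℕ.^ j) ≡⟨ lem p q (m ℕ.^ i) (m ℕ.^ j) ⟩
  p ℕ.* q ℕ.* (m ℕ.^ i ℕ.* m ℕ.^ j) ≡⟨ cong (p ℕ.* q ℕ.*_) (ℕ.^-distribˡ-+-* m i j) ⟨
  p ℕ.* q ℕ.* m ℕ.^ (i ℕ.+ j) ∎
  where
  open ℕ.≤-Reasoning
  lem : ∀ p q x y → p ℕ.* x ℕ.* (q ℕ.* y) ≡ p ℕ.* q ℕ.* (x ℕ.* y)
  lem = ℕ-Ring.solve-∀

¬Below-* : ∀ m p q i j → ¬ Below m p i → ¬ Below m q j → ¬ Below m (p ℕ.* q) (i ℕ.+ j)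
¬Below-* m p q i j a b = ℕ.<⇒≱ (begin-strict
  p ℕ.* q ℕ.* m ℕ.^ (i ℕ.+ j) ≡⟨ cong (p ℕ.* q ℕ.*_) (ℕ.^-distribˡ-+-* m i j) ⟩
  p ℕ.* q ℕ.* (m ℕ.^ i ℕ.* m ℕ.^ j) ≡⟨ lem p q (m ℕ.^ i) (m ℕ.^ j) ⟩
  p ℕ.* m ℕ.^ i ℕ.* (q ℕ.* m ℕ.^ j) <⟨ ℕ.*-mono-< (ℕ.≰⇒> a) (ℕ.≰⇒> b) ⟩
  suc m ℕ.^ i ℕ.* suc m ℕ.^ j ≡⟨ ℕ.^-distribˡ-+-* (suc m) i j ⟨
  suc m ℕ.^ (i ℕ.+ j) ∎)
  where
  open ℕ.≤-Reasoning
  lem : ∀ p q x y → p ℕ.* q ℕ.* (x ℕ.* y) ≡ p ℕ.* x ℕ.* (q ℕ.* y)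
  lem = ℕ-Ring.solve-∀

ln-*-≥ : ∀ p q .{{_ : NonZero p}} .{{_ : NonZero q}} → Pos (λ M → ln (p ℕ.* q) M - (ln p M + ln q M))
ln-*-≥ p q = Pos-nonneg λ M → i≤j⇒0≤j-i (+≤+ (ℕ.s≤s⁻¹ (Below-< (suc M) (p ℕ.* q) (log p M ℕ.+ log q M) (suc (log (p ℕ.* q) M)) {{ℕ.m*n≢0 p q}}
  (Below-* (suc M) p q (log p M) (log q M) (log-below p M) (log-below q M)) (log-above (p ℕ.* q) M {{ℕ.m*n≢0 p q}}))))

-- Rounding down twice loses less than 2, hence at most 1 in integers, and `Pos` absorbs a constant.
ln-*-≤ : ∀ p q .{{_ : NonZero p}} .{{_ : NonZero q}} → Pos (λ M → ln p M + ln q M - ln (p ℕ.* q) M)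
ln-*-≤ p q = Pos-bounded 1 λ M → subst (0ℤ ℤ.≤_) (lem (ln (p ℕ.* q) M) (ln p M) (ln q M))
  (i≤j⇒0≤j-i (+≤+ (Below-< (suc M) (p ℕ.* q) (log (p ℕ.* q) M) (suc (log p M) ℕ.+ suc (log q M)) {{ℕ.m*n≢0 p q}} (log-below (p ℕ.* q) M {{ℕ.m*n≢0 p q}})
    (¬Below-* (suc M) p q (suc (log p M)) (suc (log q M)) (log-above p M) (log-above q M)))))
  where
  lem : ∀ r a b → (1ℤ + a) + (1ℤ + b) - (1ℤ + r) ≡ a + b - r + 1ℤ
  lem = solve-∀

-- From (1 + 1/m) ^ i ≤ p and q < (1 + 1/m) ^ j follows p ≥ q (1 + 1/m) ^ (i - j). Bernoulli makes
-- the power linear, here for i ≥ j and in `tangent-≤` for i ≤ j.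
tangent-≥ : ∀ m p q i j d .{{_ : NonZero p}} .{{_ : NonZero m}} → Below m p i → ¬ Below m q j → i ≡ j ℕ.+ d → q ℕ.* (m ℕ.+ d) ℕ.≤ p ℕ.* m
tangent-≥ m p q _ j d a b refl = ℕ.*-cancelʳ-≤ _ _ (m ℕ.^ j ℕ.* m ℕ.^ d) {{ℕ.m*n≢0 _ _ {{ℕ.m^n≢0 m j}} {{ℕ.m^n≢0 m d}}}} (begin
  q ℕ.* (m ℕ.+ d) ℕ.* (m ℕ.^ j ℕ.* m ℕ.^ d)   ≡⟨ lem q (m ℕ.+ d) (m ℕ.^ j) (m ℕ.^ d) ⟩
  q ℕ.* m ℕ.^ j ℕ.* ((m ℕ.+ d) ℕ.* m ℕ.^ d)   ≤⟨ ℕ.*-mono-≤ (ℕ.<⇒≤ (ℕ.≰⇒> b)) (bernoulli m d) ⟩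
  suc m ℕ.^ j ℕ.* (m ℕ.* suc m ℕ.^ d)         ≡⟨ lem′ (suc m ℕ.^ j) m (suc m ℕ.^ d) ⟩
  m ℕ.* (suc m ℕ.^ j ℕ.* suc m ℕ.^ d)         ≡⟨ cong (m ℕ.*_) (ℕ.^-distribˡ-+-* (suc m) j d) ⟨
  m ℕ.* suc m ℕ.^ (j ℕ.+ d)                   ≤⟨ ℕ.*-monoʳ-≤ m a ⟩
  m ℕ.* (p ℕ.* m ℕ.^ (j ℕ.+ d))               ≡⟨ cong (λ x → m ℕ.* (p ℕ.* x)) (ℕ.^-distribˡ-+-* m j d) ⟩
  m ℕ.* (p ℕ.* (m ℕ.^ j ℕ.* m ℕ.^ d))         ≡⟨ lem″ m p (m ℕ.^ j ℕ.* m ℕ.^ d) ⟩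
  p ℕ.* m ℕ.* (m ℕ.^ j ℕ.* m ℕ.^ d)           ∎)
  where
  open ℕ.≤-Reasoning
  lem : ∀ q x y z → q ℕ.* x ℕ.* (y ℕ.* z) ≡ q ℕ.* y ℕ.* (x ℕ.* z)
  lem = ℕ-Ring.solve-∀
  lem′ : ∀ x m y → x ℕ.* (m ℕ.* y) ≡ m ℕ.* (x ℕ.* y)
  lem′ = ℕ-Ring.solve-∀
  lem″ : ∀ m p x → m ℕ.* (p ℕ.* x) ≡ p ℕ.* m ℕ.* x
  lem″ = ℕ-Ring.solve-∀

tangent-≤ : ∀ m p q i j d .{{_ : NonZero m}} → Below m p i → ¬ Below m q j → j ≡ i ℕ.+ d → q ℕ.* suc m ℕ.≤ p ℕ.* suc m ℕ.+ q ℕ.* d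
tangent-≤ m p q i _ d a b refl = ℕ.*-cancelʳ-≤ _ _ (suc m ℕ.^ i ℕ.* suc m ℕ.^ d) {{ℕ.m*n≢0 _ _ {{ℕ.m^n≢0 (suc m) i}} {{ℕ.m^n≢0 (suc m) d}}}} (begin
  q ℕ.* suc m ℕ.* (X ℕ.* Y) ≡⟨ lem q (suc m) X Y ⟩
  q ℕ.* X ℕ.* (suc m ℕ.* Y) ≤⟨ ℕ.*-monoʳ-≤ (q ℕ.* X) (bernoulli′ m d) ⟩
  q ℕ.* X ℕ.* (y ℕ.* suc m ℕ.+ d ℕ.* Y) ≡⟨ lem₁ q X y (suc m) d Y ⟩
  q ℕ.* y ℕ.* (X ℕ.* suc m) ℕ.+ q ℕ.* d ℕ.* (X ℕ.* Y) ≤⟨ ℕ.+-monoˡ-≤ (q ℕ.* d ℕ.* (X ℕ.* Y)) (ℕ.*-cancelʳ-≤ (q ℕ.* y ℕ.* (X ℕ.* suc m)) (p ℕ.* suc m ℕ.* (X ℕ.* Y)) x {{ℕ.m^n≢0 m i}} lt) ⟩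
  p ℕ.* suc m ℕ.* (X ℕ.* Y) ℕ.+ q ℕ.* d ℕ.* (X ℕ.* Y) ≡⟨ ℕ.*-distribʳ-+ (X ℕ.* Y) (p ℕ.* suc m) (q ℕ.* d) ⟨
  (p ℕ.* suc m ℕ.+ q ℕ.* d) ℕ.* (X ℕ.* Y) ∎)
  where
  open ℕ.≤-Reasoning
  X = suc m ℕ.^ i
  Y = suc m ℕ.^ d
  x = m ℕ.^ i
  y = m ℕ.^ d
  lem : ∀ q x y z → q ℕ.* x ℕ.* (y ℕ.* z) ≡ q ℕ.* y ℕ.* (x ℕ.* z)
  lem = ℕ-Ring.solve-∀
  lem₁ : ∀ q X y s d Y → q ℕ.* X ℕ.* (y ℕ.* s ℕ.+ d ℕ.* Y) ≡ q ℕ.* y ℕ.* (X ℕ.* s) ℕ.+ q ℕ.* d ℕ.* (X ℕ.* Y)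
  lem₁ = ℕ-Ring.solve-∀
  lem₂ : ∀ q y X s x → q ℕ.* y ℕ.* (X ℕ.* s) ℕ.* x ≡ q ℕ.* (x ℕ.* y) ℕ.* (X ℕ.* s)
  lem₂ = ℕ-Ring.solve-∀
  lem₃ : ∀ X Y p x s → X ℕ.* Y ℕ.* (p ℕ.* x ℕ.* s) ≡ p ℕ.* s ℕ.* (X ℕ.* Y) ℕ.* x
  lem₃ = ℕ-Ring.solve-∀
  lt : q ℕ.* y ℕ.* (X ℕ.* suc m) ℕ.* x ℕ.≤ p ℕ.* suc m ℕ.* (X ℕ.* Y) ℕ.* x
  lt = begin
    q ℕ.* y ℕ.* (X ℕ.* suc m) ℕ.* x ≡⟨ lem₂ q y X (suc m) x ⟩
    q ℕ.* (x ℕ.* y) ℕ.* (X ℕ.* suc m) ≡⟨ cong (λ z → q ℕ.* z ℕ.* (X ℕ.* suc m)) (ℕ.^-distribˡ-+-* m i d) ⟨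
    q ℕ.* m ℕ.^ (i ℕ.+ d) ℕ.* (X ℕ.* suc m) ≤⟨ ℕ.*-mono-≤ (ℕ.<⇒≤ (ℕ.≰⇒> b)) (ℕ.*-monoˡ-≤ (suc m) a) ⟩
    suc m ℕ.^ (i ℕ.+ d) ℕ.* (p ℕ.* x ℕ.* suc m) ≡⟨ cong (ℕ._* (p ℕ.* x ℕ.* suc m)) (ℕ.^-distribˡ-+-* (suc m) i d) ⟩
    X ℕ.* Y ℕ.* (p ℕ.* x ℕ.* suc m) ≡⟨ lem₃ X Y p x (suc m) ⟩
    p ℕ.* suc m ℕ.* (X ℕ.* Y) ℕ.* x ∎

-- log t ≤ t - 1 for t = p / q
ln-tangent : ∀ p q .{{_ : NonZero p}} .{{_ : NonZero q}} → Pos (λ M → (+ p - + q) * 𝟙 M - + q * (ln p M - ln q M))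
ln-tangent p q = Pos-bounded (p ℕ.+ q) bnd
  where
  lem₁ : ∀ p q m j d → p * m - q * (m + d) + p ≡ (p - q) * m - q * ((1ℤ + j + d) - j) + (p + q)
  lem₁ = solve-∀
  lem₂ : ∀ p q m i d → p * (1ℤ + m) + q * d - q * (1ℤ + m) + q ≡ (p - q) * m - q * (i - (i + d - 1ℤ)) + (p + q)
  lem₂ = solve-∀
  lem₃ : ∀ a b → 1ℤ + a ≡ b → a ≡ b - 1ℤ
  lem₃ a _ refl = lem′ a
    where
    lem′ : ∀ a → a ≡ 1ℤ + a - 1ℤ
    lem′ = solve-∀
  bnd : ∀ M → 0ℤ ℤ.≤ (+ p - + q) * 𝟙 M - + q * (ln p M - ln q M) + + (p ℕ.+ q)
  -- `Below` fails for q only from `suc (log q M)` on; this shift by one costs at most the constant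
  -- p + q.
  bnd M with ℕ.≤-total (suc (log q M)) (log p M)
  ... | inj₁ le with ℕ.m≤n⇒∃[o]m+o≡n le
  ...   | d , eq = subst (0ℤ ℤ.≤_)
    (trans (cong₂ (λ x y → x - y + + p) (pos-* p (suc M)) (pos-* q (suc M ℕ.+ d)))
    (trans (lem₁ (+ p) (+ q) (+ suc M) (ln q M) (+ d))
      (cong (λ x → (+ p - + q) * 𝟙 M - + q * (x - ln q M) + + (p ℕ.+ q)) (cong +_ eq))))
    (0≤-+ (i≤j⇒0≤j-i (+≤+ (tangent-≥ (suc M) p q (log p M) (suc (log q M)) d (log-below p M) (log-above q M) (sym eq)))) (0≤+ p))
  bnd M | inj₂ ge with ℕ.m≤n⇒∃[o]m+o≡n ge
  ...   | d , eq = subst (0ℤ ℤ.≤_)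
    (trans (cong₂ (λ x y → x + + (q ℕ.* d) - y + + q) (pos-* p (suc (suc M))) (pos-* q (suc (suc M))))
    (trans (cong (λ x → + p * + suc (suc M) + x - + q * + suc (suc M) + + q) (pos-* q d))
    (trans (lem₂ (+ p) (+ q) (+ suc M) (ln p M) (+ d))
      (cong (λ x → (+ p - + q) * 𝟙 M - + q * (ln p M - x) + + (p ℕ.+ q)) (sym (lem₃ (ln q M) (ln p M + + d) (cong +_ (sym eq))))))))
    (0≤-+ (i≤j⇒0≤j-i (+≤+ (tangent-≤ (suc M) p q (log p M) (suc (log q M)) d (log-below p M) (log-above q M) (sym eq)))) (0≤+ q))

-- Rational bounds for the logarithm

0<+ : ∀ n .{{_ : NonZero n}} → 0ℤ ℤ.< + n
0<+ n = +<+ (ℕ.>-nonZero⁻¹ n)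

0<-* : ∀ {x y} → 0ℤ ℤ.< x → 0ℤ ℤ.< y → 0ℤ ℤ.< x * y
0<-* {+ suc m} {+ suc n} (+<+ _) (+<+ _) = +<+ (s≤s z≤n)

Pos-cancel-* : ∀ {z f} → 0ℤ ℤ.< z → Pos (λ M → z * f M) → Pos f
Pos-cancel-* {+ suc n} (+<+ _) = Pos-cancel n

Pos-*𝟙 : ∀ {z} → 0ℤ ℤ.≤ z → Pos (λ M → z * 𝟙 M)
Pos-*𝟙 h = Pos-nonneg λ M → 0≤-* h (0≤+ (suc M))

6N+4j>0 : ∀ N j .{{_ : NonZero N}} → 0ℤ ℤ.< + 6 * + N + + 4 * + j
6N+4j>0 N j = +-mono-<-≤ (0<-* (0<+ 6) (0<+ N)) (0≤-* (0≤+ 4) (0≤+ j))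

-- The two inductions compare log with the rational function (t - 1) (t + 5) / (4 t + 2) along the points t = (N + j) / N
-- and t = i / (i + j); the linear error terms 3 j and e j become negligible when numerator and denominator are scaled up.
ln-bound-up : ∀ N j n .{{_ : NonZero N}} → n ≡ N ℕ.+ j →
  Pos (λ M → (+ j * (+ 6 * + N + + j) + + 3 * + j) * 𝟙 M - + N * (+ 6 * + N + + 4 * + j) * (ln n M - ln N M))
ln-bound-up N zero n eq with trans eq (ℕ.+-identityʳ N)
... | refl = Pos-nonneg λ M → ≤-reflexive (lem (+ N) (+ suc M) (ln N M))
  where
  lem : ∀ N m a → 0ℤ ≡ (0ℤ * (+ 6 * N + 0ℤ) + + 3 * 0ℤ) * m - N * (+ 6 * N + + 4 * 0ℤ) * (a - a)
  lem = solve-∀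
ln-bound-up N (suc j) n eq with trans eq (ℕ.+-suc N j)
... | refl =
  Pos-cancel-* (0<-* (0<+ (N ℕ.+ j) {{nz}}) (6N+4j>0 N j))
    (Pos-cong (λ M → lem (+ N) (+ j) (+ suc M) (ln N M) (ln (N ℕ.+ j) M) (ln (suc (N ℕ.+ j)) M))
      ( 0≤-* (0≤-+ (0≤-* (0≤+ 6) (0≤+ N)) (0≤-* (0≤+ 4) (0≤+ (suc j)))) (0≤+ (N ℕ.+ j)) ⊛ ln-bound-up N j (N ℕ.+ j) refl
      ⊕ 0≤-* (0≤-* (0≤+ N) (0≤-+ (0≤-* (0≤+ 6) (0≤+ N)) (0≤-* (0≤+ 4) (0≤+ j)))) (0≤-+ (0≤-* (0≤+ 6) (0≤+ N)) (0≤-* (0≤+ 4) (0≤+ (suc j))))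
        ⊛ ln-tangent (suc (N ℕ.+ j)) (N ℕ.+ j) {{_}} {{nz}}
      -- 4 j³ mirrors the numerator of (t - 1)³ / (t (2 t + 1)²), the gap between the two
      -- derivatives at t = (N + j) / N. The error term 3 j makes the terms of lower order
      -- nonnegative.
      ⊕ Pos-*𝟙 {+ 4 * (+ j * + j * + j) + + 4 * (+ j * + j) + + 12 * (+ N * + j)}
          (0≤-+ (0≤-+ (0≤-* (0≤+ 4) (0≤-* (0≤-* (0≤+ j) (0≤+ j)) (0≤+ j))) (0≤-* (0≤+ 4) (0≤-* (0≤+ j) (0≤+ j))))
            (0≤-* (0≤+ 12) (0≤-* (0≤+ N) (0≤+ j))))))
  where
  nz : NonZero (N ℕ.+ j)
  nz = ℕ.>-nonZero (ℕ.<-≤-trans (ℕ.>-nonZero⁻¹ N) (ℕ.m≤m+n N j))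
  lem : ∀ N j m a b c →
    ((+ 6 * N + + 4 * (1ℤ + j)) * (N + j)) * ((j * (+ 6 * N + j) + + 3 * j) * m - N * (+ 6 * N + + 4 * j) * (b - a))
    + (N * (+ 6 * N + + 4 * j) * (+ 6 * N + + 4 * (1ℤ + j))) * (((1ℤ + (N + j)) - (N + j)) * m - (N + j) * (c - b))
    + (+ 4 * (j * j * j) + + 4 * (j * j) + + 12 * (N * j)) * m
    ≡ ((N + j) * (+ 6 * N + + 4 * j))
      * (((1ℤ + j) * (+ 6 * N + (1ℤ + j)) + + 3 * (1ℤ + j)) * m - N * (+ 6 * N + + 4 * (1ℤ + j)) * (c - a))
  lem = solve-∀

ln-bound-down : ∀ i j n e .{{_ : NonZero i}} → n ≡ i ℕ.+ j → 3 ℕ.* (i ℕ.+ j) ℕ.≤ e ℕ.* i →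
  Pos (λ M → (+ i + + j) * (+ 6 * + i + + 2 * + j) * (ln n M - ln i M) - (+ j * (+ 6 * + i + + 5 * + j) - + e * + j) * 𝟙 M)
ln-bound-down i zero n e eq _ with trans eq (ℕ.+-identityʳ i)
... | refl = Pos-nonneg λ M → ≤-reflexive (lem (+ i) (+ e) (+ suc M) (ln i M))
  where
  lem : ∀ i e m a → 0ℤ ≡ (i + 0ℤ) * (+ 6 * i + + 2 * 0ℤ) * (a - a) - (0ℤ * (+ 6 * i + + 5 * 0ℤ) - e * 0ℤ) * m
  lem = solve-∀
ln-bound-down i (suc j) n e eq h with trans eq (ℕ.+-suc i j)
... | refl =
  Pos-cancel-* (0<-* (0<+ (suc i)) (+-mono-<-≤ (0<-* (0<+ 6) (0<+ (suc i))) (0≤-* (0≤+ 2) (0≤+ j))))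
    (Pos-cong (λ M → lem (+ i) (+ j) (+ e) (+ suc M) (ln i M) (ln (suc i) M) (ln (suc (i ℕ.+ j)) M))
      ( 0≤-* (0≤+ (suc i)) τ≥0 ⊛ ln-bound-down (suc i) j (suc (i ℕ.+ j)) e refl h′
      ⊕ 0≤-* (0≤-* (0≤+ (suc (i ℕ.+ j))) τ≥0) (0≤-+ (0≤-* (0≤+ 6) (0≤+ (suc i))) (0≤-* (0≤+ 2) (0≤+ j)))
        ⊛ ln-tangent i (suc i)
      ⊕ Pos-*𝟙 {+ 4 * (+ j * + j * + j) + + 4 * (+ j * + j) + + 6 * (+ suc (i ℕ.+ j)) * (+ j) + + 6 * + suc (i ℕ.+ j) * (+ e * + suc i - + 3 * + suc (i ℕ.+ j))}
          (0≤-+ (0≤-+ (0≤-+ (0≤-* (0≤+ 4) (0≤-* (0≤-* (0≤+ j) (0≤+ j)) (0≤+ j))) (0≤-* (0≤+ 4) (0≤-* (0≤+ j) (0≤+ j))))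
            (0≤-* (0≤-* (0≤+ 6) (0≤+ (suc (i ℕ.+ j)))) (0≤+ j)))
            (0≤-* (0≤-* (0≤+ 6) (0≤+ (suc (i ℕ.+ j))))
              (subst (λ x → 0ℤ ℤ.≤ x - + 3 * + suc (i ℕ.+ j)) (pos-* e (suc i))
                (subst (λ x → 0ℤ ℤ.≤ + (e ℕ.* suc i) - x) (pos-* 3 (suc (i ℕ.+ j))) (i≤j⇒0≤j-i (+≤+ h′))))))))
  where
  h′ : 3 ℕ.* suc (i ℕ.+ j) ℕ.≤ e ℕ.* suc i
  h′ = ℕ.≤-trans (ℕ.≤-trans (ℕ.≤-reflexive (cong (3 ℕ.*_) (sym (ℕ.+-suc i j)))) h) (ℕ.*-monoʳ-≤ e (ℕ.n≤1+n i))
  τ≥0 : 0ℤ ℤ.≤ + 6 * + i + + 2 * + suc j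
  τ≥0 = 0≤-+ (0≤-* (0≤+ 6) (0≤+ i)) (0≤-* (0≤+ 2) (0≤+ (suc j)))
  lem : ∀ i j e m a b c →
    ((1ℤ + i) * (+ 6 * i + + 2 * (1ℤ + j))) * (((1ℤ + i) + j) * (+ 6 * (1ℤ + i) + + 2 * j) * (c - b) - (j * (+ 6 * (1ℤ + i) + + 5 * j) - e * j) * m)
    + ((1ℤ + (i + j)) * (+ 6 * i + + 2 * (1ℤ + j)) * (+ 6 * (1ℤ + i) + + 2 * j)) * ((i - (1ℤ + i)) * m - (1ℤ + i) * (a - b))
    + (+ 4 * (j * j * j) + + 4 * (j * j) + + 6 * (1ℤ + (i + j)) * j + + 6 * (1ℤ + (i + j)) * (e * (1ℤ + i) - + 3 * (1ℤ + (i + j)))) * m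
    ≡ ((1ℤ + i) * (+ 6 * (1ℤ + i) + + 2 * j))
      * ((i + (1ℤ + j)) * (+ 6 * i + + 2 * (1ℤ + j)) * (c - a) - ((1ℤ + j) * (+ 6 * i + + 5 * (1ℤ + j)) - e * (1ℤ + j)) * m)
  lem = solve-∀

ln-scale : ∀ k p q .{{_ : NonZero k}} .{{_ : NonZero p}} .{{_ : NonZero q}} →
  Pos (λ M → (ln (k ℕ.* p) M - ln (k ℕ.* q) M) - (ln p M - ln q M))
ln-scale k p q = Pos-cong (λ M → lem (ln k M) (ln p M) (ln q M) (ln (k ℕ.* p) M) (ln (k ℕ.* q) M)) (ln-*-≥ k p ⊕ ln-*-≤ k q)
  where
  lem : ∀ k p q a b → (a - (k + p)) + (k + q - b) ≡ (a - b) - (p - q)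
  lem = solve-∀

-- log t ≤ (t - 1) (t + 5) / (4 t + 2) for t = p / q; the two sides agree to third order at t = 1.
ln-bound : ∀ p q .{{_ : NonZero p}} .{{_ : NonZero q}} →
  Pos (λ M → (+ p - + q) * (+ p + + 5 * + q) * 𝟙 M - + q * (+ 4 * + p + + 2 * + q) * (ln p M - ln q M))
ln-bound p q with ℕ.≤-total q p
... | inj₁ le with ℕ.m≤n⇒∃[o]m+o≡n le
...   | d , refl = Pos-limit (3 ℕ.* d) λ k →
  let K = suc k in
  Pos-cancel k (Pos-cong (λ M → trans (cong₂ (λ x y → ((y * (+ 6 * x + y) + + 3 * y) * 𝟙 M - x * (+ 6 * x + + 4 * y) * (ln (K ℕ.* (q ℕ.+ d)) M - ln (K ℕ.* q) M))
        + (+ K * + K * + q * (+ 6 * + q + + 4 * + d)) * ((ln (K ℕ.* (q ℕ.+ d)) M - ln (K ℕ.* q) M) - (ln (q ℕ.+ d) M - ln q M)))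
        (pos-* K q) (pos-* K d))
      (trans (lem (+ K) (+ q) (+ d) (+ suc M) (ln (q ℕ.+ d) M) (ln q M) (ln (K ℕ.* (q ℕ.+ d)) M) (ln (K ℕ.* q) M))
        (cong (λ x → + K * (+ K * ((+ (q ℕ.+ d) - + q) * (+ (q ℕ.+ d) + + 5 * + q) * 𝟙 M - + q * (+ 4 * + (q ℕ.+ d) + + 2 * + q) * (ln (q ℕ.+ d) M - ln q M)) + x * 𝟙 M))
          (sym (pos-* 3 d)))))
    ( ln-bound-up (K ℕ.* q) (K ℕ.* d) (K ℕ.* (q ℕ.+ d)) {{ℕ.m*n≢0 K q}} (ℕ.*-distribˡ-+ K q d)
    ⊕ 0≤-* (0≤-* (0≤-* (0≤+ K) (0≤+ K)) (0≤+ q)) (0≤-+ (0≤-* (0≤+ 6) (0≤+ q)) (0≤-* (0≤+ 4) (0≤+ d))) ⊛ ln-scale K (q ℕ.+ d) q))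
  where
  lem : ∀ K q d m a b A B → ((K * d * (+ 6 * (K * q) + K * d) + + 3 * (K * d)) * m - K * q * (+ 6 * (K * q) + + 4 * (K * d)) * (A - B))
    + (K * K * q * (+ 6 * q + + 4 * d)) * ((A - B) - (a - b))
    ≡ K * (K * (((q + d) - q) * ((q + d) + + 5 * q) * m - q * (+ 4 * (q + d) + + 2 * q) * (a - b)) + + 3 * d * m)
  lem = solve-∀
ln-bound p q | inj₂ ge with ℕ.m≤n⇒∃[o]m+o≡n ge
...   | d , refl = Pos-limit (3 ℕ.* (p ℕ.+ d) ℕ.* d) λ k →
  let K = suc k in
  Pos-cancel k (Pos-cong (λ M → trans (cong₂ (λ x y → ((x + y) * (+ 6 * x + + 2 * y) * (ln (K ℕ.* (p ℕ.+ d)) M - ln (K ℕ.* p) M) - (y * (+ 6 * x + + 5 * y) - + (3 ℕ.* (p ℕ.+ d)) * y) * 𝟙 M)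
        + (+ K * + K * + (p ℕ.+ d) * (+ 6 * + p + + 2 * + d)) * ((ln (K ℕ.* p) M - ln (K ℕ.* (p ℕ.+ d)) M) - (ln p M - ln (p ℕ.+ d) M)))
        (pos-* K p) (pos-* K d))
      (trans (lem (+ K) (+ p) (+ d) (+ (3 ℕ.* (p ℕ.+ d))) (+ suc M) (ln p M) (ln (p ℕ.+ d) M) (ln (K ℕ.* p) M) (ln (K ℕ.* (p ℕ.+ d)) M))
        (cong (λ x → + K * (+ K * ((+ p - + (p ℕ.+ d)) * (+ p + + 5 * + (p ℕ.+ d)) * 𝟙 M - + (p ℕ.+ d) * (+ 4 * + p + + 2 * + (p ℕ.+ d)) * (ln p M - ln (p ℕ.+ d) M)) + x * 𝟙 M))
          (sym (pos-* (3 ℕ.* (p ℕ.+ d)) d)))))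
    ( ln-bound-down (K ℕ.* p) (K ℕ.* d) (K ℕ.* (p ℕ.+ d)) (3 ℕ.* (p ℕ.+ d)) {{ℕ.m*n≢0 K p}} (ℕ.*-distribˡ-+ K p d) (cond K)
    ⊕ 0≤-* (0≤-* (0≤-* (0≤+ K) (0≤+ K)) (0≤+ (p ℕ.+ d))) (0≤-+ (0≤-* (0≤+ 6) (0≤+ p)) (0≤-* (0≤+ 2) (0≤+ d))) ⊛ ln-scale K p (p ℕ.+ d)))
  where
  -- As p ≥ 1, the choice e = 3 (p + d) works for every scale `K`, so the error e d stays fixed in
  -- the limit.
  cond : ∀ K → 3 ℕ.* (K ℕ.* p ℕ.+ K ℕ.* d) ℕ.≤ 3 ℕ.* (p ℕ.+ d) ℕ.* (K ℕ.* p)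
  cond K = ℕ.≤-trans (ℕ.m≤m*n _ p) (ℕ.≤-reflexive (lem′ K p d))
    where
    lem′ : ∀ K p d → 3 ℕ.* (K ℕ.* p ℕ.+ K ℕ.* d) ℕ.* p ≡ 3 ℕ.* (p ℕ.+ d) ℕ.* (K ℕ.* p)
    lem′ = ℕ-Ring.solve-∀
  lem : ∀ K p d e m a b A B → ((K * p + K * d) * (+ 6 * (K * p) + + 2 * (K * d)) * (B - A) - (K * d * (+ 6 * (K * p) + + 5 * (K * d)) - e * (K * d)) * m)
    + (K * K * (p + d) * (+ 6 * p + + 2 * d)) * ((A - B) - (a - b))
    ≡ K * (K * ((p - (p + d)) * (p + + 5 * (p + d)) * m - (p + d) * (+ 4 * p + + 2 * (p + d)) * (a - b)) + e * d * m)
  lem = solve-∀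

≤⇒∃ : ∀ {m n} → m ℕ.≤ n → ∃ λ d → n ≡ m ℕ.+ d
≤⇒∃ le with ℕ.m≤n⇒∃[o]m+o≡n le
... | d , eq = d , sym eq

-- log t ≤ (t - 1/t) / 2 for t = p / q ≥ 1
ln-upper : ∀ p q .{{_ : NonZero p}} → q ℕ.≤ p → Pos (λ M → (+ p * + p - + q * + q) * 𝟙 M - + 2 * + p * + q * (ln p M - ln q M))
ln-upper p zero _ = Pos-cong (λ M → lem (+ p) (+ suc M) (ln p M - ln 0 M)) (Pos-*𝟙 (0≤-* (0≤+ p) (0≤+ p)))
  where
  lem : ∀ p m l → p * p * m ≡ (p * p - 0ℤ * 0ℤ) * m - + 2 * p * 0ℤ * l
  lem = solve-∀
ln-upper p q@(suc _) q≤p with ≤⇒∃ q≤p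
... | d , refl = Pos-cancel-* (+-mono-<-≤ (0<-* (0<+ 4) (0<+ (q ℕ.+ d))) (0≤-* (0≤+ 2) (0≤+ q)))
  (Pos-cong (λ M → lem (+ q) (+ d) (+ suc M) (ln (q ℕ.+ d) M) (ln q M))
    ( 0≤-* (0≤+ 2) (0≤+ (q ℕ.+ d)) ⊛ ln-bound (q ℕ.+ d) q
    ⊕ Pos-*𝟙 {+ 2 * (+ d * + d * + d)} (0≤-* (0≤+ 2) (0≤-* (0≤-* (0≤+ d) (0≤+ d)) (0≤+ d)))))
  where
  lem : ∀ q d m a b → + 2 * (q + d) * (((q + d) - q) * ((q + d) + + 5 * q) * m - q * (+ 4 * (q + d) + + 2 * q) * (a - b)) + + 2 * (d * d * d) * m
    ≡ (+ 4 * (q + d) + + 2 * q) * (((q + d) * (q + d) - q * q) * m - + 2 * (q + d) * q * (a - b))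
  lem = solve-∀

-- log t ≥ 2 (t - 1) / (t + 1) for t = p / q ≥ 1
ln-lower : ∀ p q .{{_ : NonZero p}} .{{_ : NonZero q}} → q ℕ.≤ p → Pos (λ M → (+ p + + q) * (ln p M - ln q M) - + 2 * (+ p - + q) * 𝟙 M)
ln-lower p q q≤p with ≤⇒∃ q≤p
... | d , refl = Pos-cancel-* (0<-* (0<+ (q ℕ.+ d)) (+-mono-<-≤ (0<-* (0<+ 4) (0<+ q)) (0≤-* (0≤+ 2) (0≤+ (q ℕ.+ d)))))
  (Pos-cong (λ M → lem (+ q) (+ d) (+ suc M) (ln (q ℕ.+ d) M) (ln q M))
    ( 0≤-+ (0≤+ (q ℕ.+ d)) (0≤+ q) ⊛ ln-bound q (q ℕ.+ d)
    ⊕ Pos-*𝟙 {+ d * + d * + d} (0≤-* (0≤-* (0≤+ d) (0≤+ d)) (0≤+ d))))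
  where
  lem : ∀ q d m a b → ((q + d) + q) * ((q - (q + d)) * (q + + 5 * (q + d)) * m - (q + d) * (+ 4 * q + + 2 * (q + d)) * (b - a)) + d * d * d * m
    ≡ ((q + d) * (+ 4 * q + + 2 * (q + d))) * (((q + d) + q) * (a - b) - + 2 * ((q + d) - q) * m)
  lem = solve-∀

-- Homogeneous binary entropy and its concavity in log t

n-ln : ℕ → ℕ → ℤ
n-ln n M = + n * ln n M

-- (u + v) times the entropy of the distribution (u / (u + v), v / (u + v))
H : ℕ → ℕ → ℕ → ℤ
H u v M = n-ln (u ℕ.+ v) M - n-ln u M - n-ln v M

H-≡ : ∀ u v n → u ℕ.+ v ≡ n → ∀ M → H u v M ≡ n-ln n M - n-ln u M - n-ln v M
H-≡ u v _ refl M = refl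

module _ (X Y N r p₁ p₂ : ℕ) .{{_ : NonZero X}} .{{_ : NonZero Y}} .{{_ : NonZero r}}
  (Y≤X : Y ℕ.≤ X) (eqr : X ℕ.* Y ℕ.+ r ≡ N) (eq₁ : X ℕ.* X ℕ.+ p₁ ≡ N) (eq₂ : Y ℕ.* Y ℕ.+ p₂ ≡ N) where

  private
    toℤ : ∀ a b c → a ℕ.* b ℕ.+ c ≡ N → + c ≡ + N - + a * + b
    toℤ a b c eq = trans (lem (+ a * + b) (+ c)) (cong (_- + a * + b)
      (trans (cong (_+ + c) (sym (pos-* a b))) (cong +_ eq)))
      where
      lem : ∀ x c → c ≡ (x + c) - x
      lem = solve-∀
    smaller : ∀ {a b c d n} → a ℕ.+ c ≡ n → b ℕ.+ d ≡ n → a ℕ.≤ b → d ℕ.≤ c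
    smaller {a} {b} {c} {d} refl eq a≤b = ℕ.+-cancelˡ-≤ a d c (ℕ.≤-trans (ℕ.+-monoˡ-≤ d a≤b) (ℕ.≤-reflexive eq))

    p₁≤r : p₁ ℕ.≤ r
    p₁≤r = smaller eqr eq₁ (ℕ.*-monoʳ-≤ X Y≤X)
    r≤p₂ : r ℕ.≤ p₂
    r≤p₂ = smaller eq₂ eqr (ℕ.*-monoˡ-≤ Y Y≤X)
    r≤N : r ℕ.≤ N
    r≤N = ℕ.≤-trans (ℕ.m≤n+m r _) (ℕ.≤-reflexive eqr)

    lem₁ : ∀ X Y A r p₁ p₂ m a x y xy lr l₁ l₂ xx yy → r ≡ A - X * Y → p₁ ≡ A - X * X → p₂ ≡ A - Y * Y →
      ((p₂ + r) * (Y * Y)) * ((r * r - p₁ * p₁) * m - + 2 * r * p₁ * (lr - l₁))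
      + (+ 2 * r * (X * X) * p₂) * ((p₂ + r) * (l₂ - lr) - + 2 * (p₂ - r) * m)
      + ((p₂ + r) * ((X - Y) * (X - Y))) * ((A * A - r * r) * m - + 2 * A * r * (a - lr))
      + (+ 2 * r * (p₂ + r)) * ((+ 2 * (X * Y * (X * Y))) * (x + y - xy) + X * X * (Y * Y) * (xx - (x + x)) + X * X * (Y * Y) * (yy - (y + y)))
      + (+ 2 * (X * X * (Y * Y)) * ((X - Y) * (X - Y)) * r) * m
      ≡ (+ 2 * r * (p₂ + r)) * (+ 2 * (X * Y) * (A * a - X * Y * xy - r * lr) - Y * Y * (A * a - X * X * xx - p₁ * l₁) - X * X * (A * a - Y * Y * yy - p₂ * l₂))
    lem₁ X Y A _ _ _ m a x y xy lr l₁ l₂ xx yy refl refl refl = lem X Y A m a x y xy lr l₁ l₂ xx yy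
      where
      lem : ∀ X Y A m a x y xy lr l₁ l₂ xx yy →
        (((A - Y * Y) + (A - X * Y)) * (Y * Y)) * (((A - X * Y) * (A - X * Y) - (A - X * X) * (A - X * X)) * m - + 2 * (A - X * Y) * (A - X * X) * (lr - l₁))
        + (+ 2 * (A - X * Y) * (X * X) * (A - Y * Y)) * (((A - Y * Y) + (A - X * Y)) * (l₂ - lr) - + 2 * ((A - Y * Y) - (A - X * Y)) * m)
        + (((A - Y * Y) + (A - X * Y)) * ((X - Y) * (X - Y))) * ((A * A - (A - X * Y) * (A - X * Y)) * m - + 2 * A * (A - X * Y) * (a - lr))
        + (+ 2 * (A - X * Y) * ((A - Y * Y) + (A - X * Y))) * ((+ 2 * (X * Y * (X * Y))) * (x + y - xy) + X * X * (Y * Y) * (xx - (x + x)) + X * X * (Y * Y) * (yy - (y + y)))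
        + (+ 2 * (X * X * (Y * Y)) * ((X - Y) * (X - Y)) * (A - X * Y)) * m
        ≡ (+ 2 * (A - X * Y) * ((A - Y * Y) + (A - X * Y))) * (+ 2 * (X * Y) * (A * a - X * Y * xy - (A - X * Y) * lr) - Y * Y * (A * a - X * X * xx - (A - X * X) * l₁) - X * X * (A * a - Y * Y * yy - (A - Y * Y) * l₂))
      lem = solve-∀

    instance
      p₂≢0 : NonZero p₂
      p₂≢0 = ℕ.>-nonZero (ℕ.<-≤-trans (ℕ.>-nonZero⁻¹ r) r≤p₂)
      N≢0 : NonZero N
      N≢0 = ℕ.>-nonZero (ℕ.<-≤-trans (ℕ.>-nonZero⁻¹ r) r≤N)

    unfold : ∀ a b c → a ℕ.* b ℕ.+ c ≡ N → ∀ M → + N * ln N M - + a * + b * ln (a ℕ.* b) M - + c * ln c M ≡ H (a ℕ.* b) c M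
    unfold a b c eq M = sym (trans (H-≡ (a ℕ.* b) c N eq M) (cong (λ x → + N * ln N M - x * ln (a ℕ.* b) M - + c * ln c M) (pos-* a b)))

  -- Once ln (X Y) is split into ln X + ln Y, the logarithms of X and Y cancel. What remains is X²
  -- p₂ log (p₂ / r) - Y² p₁ log (r / p₁) - (X - Y)² N log (N / r). As p₁ ≤ r ≤ p₂ and r ≤ N, all
  -- three ratios are at least 1, so `ln-lower` applies to the first and `ln-upper` to the others;
  -- p₁ = 0 is allowed.
  H-concave-core : Pos (λ M → + 2 * (+ X * + Y) * H (X ℕ.* Y) r M - + Y * + Y * H (X ℕ.* X) p₁ M - + X * + X * H (Y ℕ.* Y) p₂ M)
  H-concave-core = Pos-cong (λ M → cong₂ _-_ (cong₂ (λ x y → + 2 * (+ X * + Y) * x - + Y * + Y * y) (unfold X Y r eqr M) (unfold X X p₁ eq₁ M))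
      (cong (+ X * + X *_) (unfold Y Y p₂ eq₂ M)))
    (Pos-cancel-* (0<-* (0<-* (0<+ 2) (0<+ r)) (+-mono-<-≤ (0<+ p₂) (0≤+ r)))
    (Pos-cong (λ M → lem₁ (+ X) (+ Y) (+ N) (+ r) (+ p₁) (+ p₂) (+ suc M) (ln N M) (ln X M) (ln Y M) (ln (X ℕ.* Y) M) (ln r M) (ln p₁ M) (ln p₂ M)
        (ln (X ℕ.* X) M) (ln (Y ℕ.* Y) M) (toℤ X Y r eqr) (toℤ X X p₁ eq₁) (toℤ Y Y p₂ eq₂))
      ( 0≤-* p₂+r≥0 (0≤-* (0≤+ Y) (0≤+ Y)) ⊛ ln-upper r p₁ p₁≤r
      ⊕ 0≤-* (0≤-* (0≤-* (0≤+ 2) (0≤+ r)) (0≤-* (0≤+ X) (0≤+ X))) (0≤+ p₂) ⊛ ln-lower p₂ r r≤p₂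
      ⊕ 0≤-* p₂+r≥0 (0≤-square (+ X - + Y)) ⊛ ln-upper N r r≤N
      ⊕ 0≤-* (0≤-* (0≤+ 2) (0≤+ r)) p₂+r≥0 ⊛
        ( 0≤-* (0≤+ 2) (0≤-* (0≤-* (0≤+ X) (0≤+ Y)) (0≤-* (0≤+ X) (0≤+ Y))) ⊛ ln-*-≤ X Y
        ⊕ XXYY≥0 ⊛ ln-*-≥ X X
        ⊕ XXYY≥0 ⊛ ln-*-≥ Y Y)
      ⊕ Pos-*𝟙 (0≤-* (0≤-* (0≤-* (0≤+ 2) XXYY≥0) (0≤-square (+ X - + Y))) (0≤+ r)))))
    where
    p₂+r≥0 : 0ℤ ℤ.≤ + p₂ + + r
    p₂+r≥0 = 0≤-+ (0≤+ p₂) (0≤+ r)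
    XXYY≥0 : 0ℤ ℤ.≤ + X * + X * (+ Y * + Y)
    XXYY≥0 = 0≤-* (0≤-square (+ X)) (0≤-square (+ Y))

n-ln-*-≥ : ∀ k n .{{_ : NonZero k}} → Pos (λ M → n-ln (k ℕ.* n) M - (+ k * n-ln n M + + k * + n * ln k M))
n-ln-*-≥ k zero = Pos-nonneg λ M → ≤-reflexive (trans (lem (+ k) (ln k M) (ln 0 M))
    (cong (λ x → n-ln x M - (+ k * n-ln 0 M + + k * 0ℤ * ln k M)) (sym (ℕ.*-zeroʳ k))))
  where
  lem : ∀ k a b → 0ℤ ≡ 0ℤ * b - (k * (0ℤ * b) + k * 0ℤ * a)
  lem = solve-∀
n-ln-*-≥ k n@(suc _) = Pos-cong (λ M → trans (lem (+ k) (+ n) (ln k M) (ln n M) (ln (k ℕ.* n) M)) (cong (λ x → x * ln (k ℕ.* n) M - (+ k * n-ln n M + + k * + n * ln k M)) (sym (pos-* k n))))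
  (0≤-* (0≤+ k) (0≤+ n) ⊛ ln-*-≥ k n)
  where
  lem : ∀ k n a b c → k * n * (c - (a + b)) ≡ k * n * c - (k * (n * b) + k * n * a)
  lem = solve-∀

n-ln-*-≤ : ∀ k n .{{_ : NonZero k}} → Pos (λ M → (+ k * n-ln n M + + k * + n * ln k M) - n-ln (k ℕ.* n) M)
n-ln-*-≤ k zero = Pos-nonneg λ M → ≤-reflexive (trans (lem (+ k) (ln k M) (ln 0 M))
    (cong (λ x → (+ k * n-ln 0 M + + k * 0ℤ * ln k M) - n-ln x M) (sym (ℕ.*-zeroʳ k))))
  where
  lem : ∀ k a b → 0ℤ ≡ (k * (0ℤ * b) + k * 0ℤ * a) - 0ℤ * b
  lem = solve-∀
n-ln-*-≤ k n@(suc _) = Pos-cong (λ M → trans (lem (+ k) (+ n) (ln k M) (ln n M) (ln (k ℕ.* n) M)) (cong (λ x → (+ k * n-ln n M + + k * + n * ln k M) - x * ln (k ℕ.* n) M) (sym (pos-* k n))))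
  (0≤-* (0≤+ k) (0≤+ n) ⊛ ln-*-≤ k n)
  where
  lem : ∀ k n a b c → k * n * ((a + b) - c) ≡ (k * (n * b) + k * n * a) - k * n * c
  lem = solve-∀

H-scale-≥ : ∀ k u v .{{_ : NonZero k}} → Pos (λ M → H (k ℕ.* u) (k ℕ.* v) M - + k * H u v M)
H-scale-≥ k u v = Pos-cong (λ M → trans (lem (+ k) (+ u) (+ v) (ln k M) (n-ln u M) (n-ln v M) (n-ln (u ℕ.+ v) M) (n-ln (k ℕ.* u) M) (n-ln (k ℕ.* v) M) (n-ln (k ℕ.* (u ℕ.+ v)) M))
    (cong (_- + k * H u v M) (sym (H-≡ (k ℕ.* u) (k ℕ.* v) _ (sym (ℕ.*-distribˡ-+ k u v)) M))))
  (n-ln-*-≥ k (u ℕ.+ v) ⊕ n-ln-*-≤ k u ⊕ n-ln-*-≤ k v)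
  where
  lem : ∀ k u v l a b c a′ b′ c′ → (c′ - (k * c + k * (u + v) * l)) + ((k * a + k * u * l) - a′) + ((k * b + k * v * l) - b′)
    ≡ (c′ - a′ - b′) - k * (c - a - b)
  lem = solve-∀

H-scale-≤ : ∀ k u v .{{_ : NonZero k}} → Pos (λ M → + k * H u v M - H (k ℕ.* u) (k ℕ.* v) M)
H-scale-≤ k u v = Pos-cong (λ M → trans (lem (+ k) (+ u) (+ v) (ln k M) (n-ln u M) (n-ln v M) (n-ln (u ℕ.+ v) M) (n-ln (k ℕ.* u) M) (n-ln (k ℕ.* v) M) (n-ln (k ℕ.* (u ℕ.+ v)) M))
    (cong (λ x → + k * H u v M - x) (sym (H-≡ (k ℕ.* u) (k ℕ.* v) _ (sym (ℕ.*-distribˡ-+ k u v)) M))))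
  (n-ln-*-≤ k (u ℕ.+ v) ⊕ n-ln-*-≥ k u ⊕ n-ln-*-≥ k v)
  where
  lem : ∀ k u v l a b c a′ b′ c′ → ((k * c + k * (u + v) * l) - c′) + (a′ - (k * a + k * u * l)) + (b′ - (k * b + k * v * l))
    ≡ k * (c - a - b) - (c′ - a′ - b′)
  lem = solve-∀

module _ (a m b n r p₁ p₂ : ℕ) .{{_ : NonZero a}} .{{_ : NonZero m}} .{{_ : NonZero b}} .{{_ : NonZero n}} .{{_ : NonZero r}}
  (eqr : a ℕ.* b ℕ.+ r ≡ m ℕ.* n) (eq₁ : a ℕ.* a ℕ.+ p₁ ≡ m ℕ.* m) (eq₂ : b ℕ.* b ℕ.+ p₂ ≡ n ℕ.* n) (Y≤X : b ℕ.* m ℕ.≤ a ℕ.* n) where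

  private
    N = m ℕ.* n ℕ.* (m ℕ.* n)

    scaled : ∀ k {X x y z} → X ≡ k ℕ.* x → x ℕ.+ y ≡ z → k ℕ.* z ≡ N → X ℕ.+ k ℕ.* y ≡ N
    scaled k {x = x} {y} refl refl eq = trans (sym (ℕ.*-distribˡ-+ k x y)) eq

    swap₁ : ∀ a n b m → a ℕ.* n ℕ.* (b ℕ.* m) ≡ m ℕ.* n ℕ.* (a ℕ.* b)
    swap₁ = ℕ-Ring.solve-∀
    swap₂ : ∀ a n → a ℕ.* n ℕ.* (a ℕ.* n) ≡ n ℕ.* n ℕ.* (a ℕ.* a)
    swap₂ = ℕ-Ring.solve-∀

    instance
      an≢0 : NonZero (a ℕ.* n)
      an≢0 = ℕ.m*n≢0 a n
      bm≢0 : NonZero (b ℕ.* m)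
      bm≢0 = ℕ.m*n≢0 b m
      mn≢0 : NonZero (m ℕ.* n)
      mn≢0 = ℕ.m*n≢0 m n
      mm≢0 : NonZero (m ℕ.* m)
      mm≢0 = ℕ.m*n≢0 m m
      nn≢0 : NonZero (n ℕ.* n)
      nn≢0 = ℕ.m*n≢0 n n

    lem : ∀ a m b n hr h₁ h₂ hr′ h₁′ h₂′ →
      (+ 2 * ((a * n) * (b * m)) * hr′ - (b * m) * (b * m) * h₁′ - (a * n) * (a * n) * h₂′)
      + + 2 * ((a * n) * (b * m)) * (m * n * hr - hr′)
      + (b * m) * (b * m) * (h₁′ - n * n * h₁) + (a * n) * (a * n) * (h₂′ - m * m * h₂)
      ≡ (m * n * (m * n)) * (+ 2 * (a * b) * hr - b * b * h₁ - a * a * h₂)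
    lem = solve-∀

    cast : ∀ {x x′ y y′ z z′ u u′ v v′ : ℤ} {hr h₁ h₂ hr′ h₁′ h₂′} → x ≡ x′ → y ≡ y′ → z ≡ z′ → u ≡ u′ → v ≡ v′ →
      (+ 2 * (x * y) * hr′ - y * y * h₁′ - x * x * h₂′) + + 2 * (x * y) * (z * hr - hr′) + y * y * (h₁′ - v * h₁) + x * x * (h₂′ - u * h₂)
      ≡ (+ 2 * (x′ * y′) * hr′ - y′ * y′ * h₁′ - x′ * x′ * h₂′) + + 2 * (x′ * y′) * (z′ * hr - hr′) + y′ * y′ * (h₁′ - v′ * h₁) + x′ * x′ * (h₂′ - u′ * h₂)
    cast refl refl refl refl refl = refl

  -- Puts both fractions over the denominator m n: `H-concave-core` with X = a n, Y = b m and N = (m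
  -- n)², divided by (m n)².
  H-concave-≥ : Pos (λ M → + 2 * (+ a * + b) * H (a ℕ.* b) r M - + b * + b * H (a ℕ.* a) p₁ M - + a * + a * H (b ℕ.* b) p₂ M)
  H-concave-≥ = Pos-cancel-* (0<-* (0<-* (0<+ m) (0<+ n)) (0<-* (0<+ m) (0<+ n)))
    (Pos-cong (λ M → trans (cast (pos-* a n) (pos-* b m) (pos-* m n) (pos-* m m) (pos-* n n))
        (lem (+ a) (+ m) (+ b) (+ n) (H (a ℕ.* b) r M) (H (a ℕ.* a) p₁ M) (H (b ℕ.* b) p₂ M)
          (H (a ℕ.* n ℕ.* (b ℕ.* m)) (m ℕ.* n ℕ.* r) M) (H (a ℕ.* n ℕ.* (a ℕ.* n)) (n ℕ.* n ℕ.* p₁) M) (H (b ℕ.* m ℕ.* (b ℕ.* m)) (m ℕ.* m ℕ.* p₂) M)))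
      ( H-concave-core (a ℕ.* n) (b ℕ.* m) N (m ℕ.* n ℕ.* r) (n ℕ.* n ℕ.* p₁) (m ℕ.* m ℕ.* p₂) {{an≢0}} {{bm≢0}} {{ℕ.m*n≢0 (m ℕ.* n) r}} Y≤X
          (scaled (m ℕ.* n) (swap₁ a n b m) eqr refl) (scaled (n ℕ.* n) (swap₂ a n) eq₁ (sym (swap₂ m n)))
          (scaled (m ℕ.* m) (swap₂ b m) eq₂ (trans (sym (swap₂ n m)) (cong (λ x → x ℕ.* x) (ℕ.*-comm n m))))
      ⊕ 0≤-* (0≤+ 2) (0≤-* (0≤+ (a ℕ.* n)) (0≤+ (b ℕ.* m))) ⊛
          subst (λ x → Pos (λ M → + (m ℕ.* n) * H (a ℕ.* b) r M - H x (m ℕ.* n ℕ.* r) M)) (sym (swap₁ a n b m)) (H-scale-≤ (m ℕ.* n) (a ℕ.* b) r)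
      ⊕ 0≤-square (+ (b ℕ.* m)) ⊛
          subst (λ x → Pos (λ M → H x (n ℕ.* n ℕ.* p₁) M - + (n ℕ.* n) * H (a ℕ.* a) p₁ M)) (sym (swap₂ a n)) (H-scale-≥ (n ℕ.* n) (a ℕ.* a) p₁)
      ⊕ 0≤-square (+ (a ℕ.* n)) ⊛
          subst (λ x → Pos (λ M → H x (m ℕ.* m ℕ.* p₂) M - + (m ℕ.* m) * H (b ℕ.* b) p₂ M)) (sym (swap₂ b m)) (H-scale-≥ (m ℕ.* m) (b ℕ.* b) p₂)))

-- With x = a / m, y = b / n and h the binary entropy: h (x y) / (x y) ≥ (h (x²) / x² + h (y²) / y²) / 2.
H-concave : ∀ a m b n r p₁ p₂ .{{_ : NonZero a}} .{{_ : NonZero m}} .{{_ : NonZero b}} .{{_ : NonZero n}} .{{_ : NonZero r}} →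
  a ℕ.* b ℕ.+ r ≡ m ℕ.* n → a ℕ.* a ℕ.+ p₁ ≡ m ℕ.* m → b ℕ.* b ℕ.+ p₂ ≡ n ℕ.* n →
  Pos (λ M → + 2 * (+ a * + b) * H (a ℕ.* b) r M - + b * + b * H (a ℕ.* a) p₁ M - + a * + a * H (b ℕ.* b) p₂ M)
H-concave a m b n r p₁ p₂ eqr eq₁ eq₂ with ℕ.≤-total (b ℕ.* m) (a ℕ.* n)
... | inj₁ Y≤X = H-concave-≥ a m b n r p₁ p₂ eqr eq₁ eq₂ Y≤X
... | inj₂ X≤Y = Pos-cong (λ M → trans (lem (+ a) (+ b) (H (b ℕ.* a) r M) (H (a ℕ.* a) p₁ M) (H (b ℕ.* b) p₂ M))
    (cong (λ x → + 2 * (+ a * + b) * H x r M - + b * + b * H (a ℕ.* a) p₁ M - + a * + a * H (b ℕ.* b) p₂ M) (ℕ.*-comm b a)))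
  (H-concave-≥ b n a m r p₂ p₁ (trans (cong (ℕ._+ r) (ℕ.*-comm b a)) (trans eqr (ℕ.*-comm m n))) eq₂ eq₁ X≤Y)
  where
  lem : ∀ a b hr h₁ h₂ → + 2 * (b * a) * hr - a * a * h₂ - b * b * h₁ ≡ + 2 * (a * b) * hr - b * b * h₁ - a * a * h₂
  lem = solve-∀

-- Binary forms and the golden ratio

-- Binary forms of degree d with integer coefficients, normalised to the vector (c₀, …, c_d) standing for Σ cᵢ aⁱ bᵈ⁻ⁱ.
infixl 6 _⊞_ _⊟_
infixl 7 _⊠_
data Form : ℕ → Set where
  𝕒 𝕓     : Form 1
  con     : ℤ → Form 0
  coeffs  : ∀ {d} → Vec ℤ (suc d) → Form d
  _⊞_ _⊟_ : ∀ {d} → Form d → Form d → Form d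
  _⊠_     : ∀ {d e} → Form d → Form e → Form (d ℕ.+ e)

eval : ∀ {d} → Vec ℤ (suc d) → ℤ → ℤ → ℤ
eval (c ∷ [])               a b = c
eval {suc d} (c ∷ cs@(_ ∷ _)) a b = c * b ^ suc d + a * eval cs a b

⟦_⟧ : ∀ {d} → Form d → ℤ → ℤ → ℤ
⟦ 𝕒 ⟧        a b = a
⟦ 𝕓 ⟧        a b = b
⟦ con c ⟧    a b = c
⟦ coeffs v ⟧ a b = eval v a b
⟦ p ⊞ q ⟧    a b = ⟦ p ⟧ a b + ⟦ q ⟧ a b
⟦ p ⊟ q ⟧    a b = ⟦ p ⟧ a b - ⟦ q ⟧ a b
⟦ p ⊠ q ⟧    a b = ⟦ p ⟧ a b * ⟦ q ⟧ a b

pad : ∀ k {d} → Vec ℤ (suc d) → Vec ℤ (suc (k ℕ.+ d))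
pad zero    v = v
pad (suc k) v = pad k v ∷ʳ 0ℤ

mul : ∀ {d e} → Vec ℤ (suc d) → Vec ℤ (suc e) → Vec ℤ (suc (d ℕ.+ e))
mul {zero}  (c ∷ []) w = map (c *_) w
mul {suc d} (c ∷ v)  w = zipWith _+_ (map (c *_) (pad (suc d) w)) (0ℤ ∷ mul v w)

nf : ∀ {d} → Form d → Vec ℤ (suc d)
nf 𝕒          = 0ℤ ∷ 1ℤ ∷ []
nf 𝕓          = 1ℤ ∷ 0ℤ ∷ []
nf (con c)    = c ∷ []
nf (coeffs v) = v
nf (p ⊞ q)    = zipWith _+_ (nf p) (nf q)
nf (p ⊟ q)    = zipWith _-_ (nf p) (nf q)
nf (p ⊠ q)    = mul (nf p) (nf q)

eval-∷ : ∀ {d} c (v : Vec ℤ (suc d)) a b → eval (c ∷ v) a b ≡ c * b ^ suc d + a * eval v a b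
eval-∷ c (_ ∷ _) a b = refl

eval-map : ∀ {d} c (v : Vec ℤ (suc d)) a b → eval (map (c *_) v) a b ≡ c * eval v a b
eval-map c (x ∷ []) a b = refl
eval-map {suc d} c (x ∷ v@(_ ∷ _)) a b = trans (cong (λ z → c * x * b ^ suc d + a * z) (eval-map c v a b)) (lem c x (b ^ suc d) a (eval v a b))
  where
  lem : ∀ c x y a z → c * x * y + a * (c * z) ≡ c * (x * y + a * z)
  lem = solve-∀

eval-+ : ∀ {d} (v w : Vec ℤ (suc d)) a b → eval (zipWith _+_ v w) a b ≡ eval v a b + eval w a b
eval-+ (x ∷ []) (y ∷ []) a b = refl
eval-+ {suc d} (x ∷ v@(_ ∷ _)) (y ∷ w@(_ ∷ _)) a b = trans (cong (λ z → (x + y) * b ^ suc d + a * z) (eval-+ v w a b)) (lem x y (b ^ suc d) a (eval v a b) (eval w a b))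
  where
  lem : ∀ x y p a u v → (x + y) * p + a * (u + v) ≡ (x * p + a * u) + (y * p + a * v)
  lem = solve-∀

eval-- : ∀ {d} (v w : Vec ℤ (suc d)) a b → eval (zipWith _-_ v w) a b ≡ eval v a b - eval w a b
eval-- (x ∷ []) (y ∷ []) a b = refl
eval-- {suc d} (x ∷ v@(_ ∷ _)) (y ∷ w@(_ ∷ _)) a b = trans (cong (λ z → (x - y) * b ^ suc d + a * z) (eval-- v w a b)) (lem x y (b ^ suc d) a (eval v a b) (eval w a b))
  where
  lem : ∀ x y p a u v → (x - y) * p + a * (u - v) ≡ (x * p + a * u) - (y * p + a * v)
  lem = solve-∀

eval-∷ʳ : ∀ {d} (v : Vec ℤ (suc d)) a b → eval (v ∷ʳ 0ℤ) a b ≡ b * eval v a b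
eval-∷ʳ (x ∷ []) a b = lem x a b
  where
  lem : ∀ x a b → x * (b * 1ℤ) + a * 0ℤ ≡ b * x
  lem = solve-∀
eval-∷ʳ {suc d} (x ∷ v@(_ ∷ _)) a b = trans (cong (λ z → x * b ^ suc (suc d) + a * z) (eval-∷ʳ v a b)) (lem x b (b ^ suc d) a (eval v a b))
  where
  lem : ∀ x b p a u → x * (b * p) + a * (b * u) ≡ b * (x * p + a * u)
  lem = solve-∀

eval-pad : ∀ k {d} (v : Vec ℤ (suc d)) a b → eval (pad k v) a b ≡ b ^ k * eval v a b
eval-pad zero v a b = lem (eval v a b)
  where
  lem : ∀ x → x ≡ 1ℤ * x
  lem = solve-∀
eval-pad (suc k) v a b = trans (eval-∷ʳ (pad k v) a b) (trans (cong (b *_) (eval-pad k v a b)) (lem b (b ^ k) (eval v a b)))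
  where
  lem : ∀ b p x → b * (p * x) ≡ b * p * x
  lem = solve-∀

eval-mul : ∀ {d e} (v : Vec ℤ (suc d)) (w : Vec ℤ (suc e)) a b → eval (mul v w) a b ≡ eval v a b * eval w a b
eval-mul {zero} (c ∷ []) w a b = eval-map c w a b
eval-mul {suc d} (c ∷ v@(_ ∷ _)) w a b =
  trans (eval-+ (map (c *_) (pad (suc d) w)) (0ℤ ∷ mul v w) a b)
  (trans (cong₂ _+_ (trans (eval-map c (pad (suc d) w) a b) (cong (c *_) (eval-pad (suc d) w a b)))
      (trans (eval-∷ 0ℤ (mul v w) a b) (cong (λ z → 0ℤ + a * z) (eval-mul v w a b))))
    (lem c (b ^ suc d) (eval w a b) a (eval v a b)))
  where
  lem : ∀ c p w a v → c * (p * w) + (0ℤ + a * (v * w)) ≡ (c * p + a * v) * w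
  lem = solve-∀

nf-correct : ∀ {d} (p : Form d) a b → eval (nf p) a b ≡ ⟦ p ⟧ a b
nf-correct 𝕒 a b = lem a b
  where
  lem : ∀ a b → 0ℤ * (b * 1ℤ) + a * 1ℤ ≡ a
  lem = solve-∀
nf-correct 𝕓 a b = lem a b
  where
  lem : ∀ a b → 1ℤ * (b * 1ℤ) + a * 0ℤ ≡ b
  lem = solve-∀
nf-correct (con c) a b = refl
nf-correct (coeffs v) a b = refl
nf-correct (p ⊞ q) a b = trans (eval-+ (nf p) (nf q) a b) (cong₂ _+_ (nf-correct p a b) (nf-correct q a b))
nf-correct (p ⊟ q) a b = trans (eval-- (nf p) (nf q) a b) (cong₂ _-_ (nf-correct p a b) (nf-correct q a b))
nf-correct (p ⊠ q) a b = trans (eval-mul (nf p) (nf q) a b) (cong₂ _*_ (nf-correct p a b) (nf-correct q a b))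

-- Proof by reflection: comparing coefficient vectors is a computation with closed integers, so
-- `refl` settles identities of degree 22.
nf-≡ : ∀ {d} (p q : Form d) → nf p ≡ nf q → ∀ a b → ⟦ p ⟧ a b ≡ ⟦ q ⟧ a b
nf-≡ p q eq a b = trans (sym (nf-correct p a b)) (trans (cong (λ v → eval v a b) eq) (nf-correct q a b))

0≤-^ : ∀ {b} → 0ℤ ℤ.≤ b → ∀ d → 0ℤ ℤ.≤ b ^ d
0≤-^ h zero    = 0≤+ 1
0≤-^ h (suc d) = 0≤-* h (0≤-^ h d)

0≤-eval : ∀ {d} {v : Vec ℤ (suc d)} → All (0ℤ ℤ.≤_) v → ∀ {a b} → 0ℤ ℤ.≤ a → 0ℤ ℤ.≤ b → 0ℤ ℤ.≤ eval v a b
0≤-eval (h ∷ []) 0≤a 0≤b = h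
0≤-eval {suc d} (h ∷ hs@(_ ∷ _)) 0≤a 0≤b = 0≤-+ (0≤-* h (0≤-^ 0≤b (suc d))) (0≤-* 0≤a (0≤-eval hs 0≤a 0≤b))

-- Nonnegative coefficients are a certificate on the quadrant a, b ≥ 0, and evaluation checks them.
0≤-form : ∀ {d} (p : Form d) → True (all? (0ℤ ℤ.≤?_) (nf p)) → ∀ {a b} → 0ℤ ℤ.≤ a → 0ℤ ℤ.≤ b → 0ℤ ℤ.≤ ⟦ p ⟧ a b
0≤-form p t {a} {b} 0≤a 0≤b = subst (0ℤ ℤ.≤_) (nf-correct p a b) (0≤-eval (toWitness t) 0≤a 0≤b)

-- With x = a / m: 𝔢 is m² (1 - x - x²) and vanishes at x = 1 / φ, and Q 𝔸 - P 𝔹 is the numerator of the rational lower bound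
-- for h (x²) - (P / Q) x h (x) that results from replacing each logarithm by its rational bound. As 𝔸² - 𝔸 𝔹 - 𝔹² = 𝔢² Ω with Ω ≥ 0,
-- the quotient 𝔸 / 𝔹 is at least φ. Only x → 1 is out of reach, whence 𝕫 ≥ 0.
𝕞 𝕤 : Form 1
𝕞 = 𝕒 ⊞ 𝕓
𝕤 = 𝕒 ⊞ 𝕞
𝔢 𝔲 𝔻₁ 𝔻₂ : Form 2
𝔢 = 𝕞 ⊠ 𝕞 ⊟ 𝕒 ⊠ 𝕤
𝔲 = 𝕒 ⊠ 𝕤 ⊞ con (+ 5) ⊠ (𝕞 ⊠ 𝕞)
𝔻₁ = 𝕤 ⊠ (con (+ 2) ⊠ 𝕞 ⊞ 𝕤)
𝔻₂ = con (+ 2) ⊠ (𝕒 ⊠ 𝕤) ⊞ 𝕞 ⊠ 𝕞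
𝔴 𝔻₃ : Form 3
𝔴 = 𝕓 ⊠ (𝕤 ⊠ 𝕤) ⊞ con (+ 5) ⊠ (𝕞 ⊠ 𝕞 ⊠ 𝕞)
𝔻₃ = con (+ 2) ⊠ (𝕓 ⊠ (𝕤 ⊠ 𝕤)) ⊞ 𝕞 ⊠ 𝕞 ⊠ 𝕞
𝔾 : Form 9
𝔾 = (con (+ 5) ⊠ 𝕤 ⊞ 𝕞) ⊠ (𝕞 ⊠ 𝕞 ⊠ 𝕞) ⊠ (𝔻₂ ⊠ 𝔻₃)
𝔸 𝔹 : Form 11
𝔸 = (𝕞 ⊠ 𝕞 ⊞ 𝕒 ⊠ 𝕒) ⊠ 𝔾 ⊞ 𝔢 ⊠ 𝔻₁ ⊠ (con (+ 2) ⊠ (𝕒 ⊠ 𝕞 ⊠ 𝔲 ⊠ 𝔻₃) ⊟ 𝕓 ⊠ 𝕤 ⊠ 𝔴 ⊠ 𝔻₂)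
𝔹 = (con (+ 2) ⊠ (𝕒 ⊠ 𝕞) ⊟ 𝕒 ⊠ 𝕒) ⊠ 𝔾 ⊞ 𝔢 ⊠ 𝔻₁ ⊠ (𝕒 ⊠ 𝕞 ⊠ 𝔲 ⊠ 𝔻₃ ⊟ 𝕓 ⊠ 𝕒 ⊠ 𝔴 ⊠ 𝔻₂)

𝕒^10 : Form 10
𝕒^10 = (𝕒 ⊠ 𝕒 ⊠ 𝕒 ⊠ 𝕒 ⊠ 𝕒) ⊠ (𝕒 ⊠ 𝕒 ⊠ 𝕒 ⊠ 𝕒 ⊠ 𝕒)

𝕫 : Form 1
𝕫 = con (+ 16) ⊠ 𝕓 ⊟ 𝕒

Ω : Form 18
Ω = coeffs (+ 0 ∷ + 0 ∷ + 891 ∷ + 17496 ∷ + 158112 ∷ + 871740 ∷ + 3275993 ∷ + 8875552 ∷ + 17870574 ∷ + 27144161 ∷ + 31212634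
  ∷ + 26976104 ∷ + 17182590 ∷ + 7768343 ∷ + 2325779 ∷ + 400352 ∷ + 26742 ∷ - + 428 ∷ + 1 ∷ [])

quadratic : ∀ a b → ⟦ 𝔸 ⊠ 𝔸 ⊟ 𝔸 ⊠ 𝔹 ⊟ 𝔹 ⊠ 𝔹 ⟧ a b ≡ ⟦ 𝔢 ⊠ 𝔢 ⊠ Ω ⟧ a b
quadratic = nf-≡ (𝔸 ⊠ 𝔸 ⊟ 𝔸 ⊠ 𝔹 ⊟ 𝔹 ⊠ 𝔹) (𝔢 ⊠ 𝔢 ⊠ Ω) refl

0≤Ω : ∀ {a b} → 0ℤ ℤ.≤ a → 0ℤ ℤ.≤ b → 0ℤ ℤ.≤ ⟦ 𝕫 ⟧ a b → 0ℤ ℤ.≤ ⟦ Ω ⟧ a b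
0≤Ω {a} {b} ha hb hz = subst (0ℤ ℤ.≤_) (lem (⟦ Ω ⟧ a b) (⟦ R ⟧ a b))
  (0≤-+ (0≤-form (Ω ⊟ R) _ ha hb) (0≤-* (0≤-form (con (+ 428) ⊠ 𝕒^10 ⊠ (𝕒 ⊠ 𝕒 ⊠ 𝕒 ⊠ 𝕒 ⊠ 𝕒 ⊠ 𝕒 ⊠ 𝕓)) _ ha hb) hz))
  where
  R : Form 18
  -- The only negative coefficient of `Ω` is - 428, at a¹⁷ b; adding 428 a¹⁶ b (a - 16 b) cancels it
  -- and leaves the coefficient of a¹⁶ b² positive.
  R = con (+ 428) ⊠ 𝕒^10 ⊠ (𝕒 ⊠ 𝕒 ⊠ 𝕒 ⊠ 𝕒 ⊠ 𝕒 ⊠ 𝕒 ⊠ 𝕓) ⊠ 𝕫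
  lem : ∀ x y → x - y + y ≡ x
  lem = solve-∀

0≤𝔸 : ∀ {a b} → 0ℤ ℤ.≤ a → 0ℤ ℤ.≤ b → 0ℤ ℤ.≤ ⟦ 𝕫 ⟧ a b → 0ℤ ℤ.≤ ⟦ 𝔸 ⟧ a b
0≤𝔸 {a} {b} ha hb hz = subst (0ℤ ℤ.≤_) (lem (⟦ 𝔸 ⟧ a b) (⟦ R ⟧ a b))
  (0≤-+ (0≤-form (𝔸 ⊟ R) _ ha hb) (0≤-* (0≤-form (con (+ 2) ⊠ 𝕒^10) _ ha hb) hz))
  where
  R : Form 11
  -- The only negative coefficient of `𝔸` is - 2, at a¹¹.
  R = con (+ 2) ⊠ 𝕒^10 ⊠ 𝕫
  lem : ∀ x y → x - y + y ≡ x
  lem = solve-∀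

-- P / Q ≤ φ ≤ A / B
golden-≤ : ∀ {A B P Q} → 0ℤ ℤ.≤ A → 0ℤ ℤ.≤ Q → 0ℤ ℤ.≤ A * A - A * B - B * B → 0ℤ ℤ.≤ P * Q + Q * Q - P * P → 0ℤ ℤ.≤ Q * A - P * B
golden-≤ {A} {B} {P} {Q} hA hQ h₁ h₂ = helper (P * B - Q * A) refl
  where
  lem : ∀ Q A P B → - (P * B - Q * A) ≡ Q * A - P * B
  lem = solve-∀
  lem₁ : ∀ Q A P B → Q * Q * (A * A - A * B - B * B) + B * B * (P * Q + Q * Q - P * P)
    ≡ (P * B - Q * A) * (Q * B - + 2 * (Q * A) - (P * B - Q * A))
  lem₁ = solve-∀
  lem₂ : ∀ Q A P B → let u = Q * A ; δ = P * B - Q * A ; w = Q * B - + 2 * (Q * A) - (P * B - Q * A) in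
    Q * Q * (A * A - A * B - B * B) + (+ 5 * (u * u) + + 5 * (u * δ) + + 5 * (u * w) + w * w + + 2 * (δ * w)) ≡ - (δ * δ)
  lem₂ = solve-∀
  helper : ∀ δ → P * B - Q * A ≡ δ → 0ℤ ℤ.≤ Q * A - P * B
  helper -[1+ n ] eq = subst (0ℤ ℤ.≤_) (trans (cong -_ (sym eq)) (lem Q A P B)) (0≤+ (suc n))
  helper (+ zero) eq = subst (0ℤ ℤ.≤_) (trans (cong -_ (sym eq)) (lem Q A P B)) (0≤+ 0)
  -- If δ = P B - Q A is positive, `lem₁` exhibits δ w as a sum of nonnegative terms, so w ≥ 0. Then
  -- every term on the left of `lem₂` is nonnegative, yet the sum is - δ².
  helper (+ suc k) eq = ⊥-elim (absurd (subst (λ δ → 0ℤ ℤ.≤ - (δ * δ)) eq (subst (0ℤ ℤ.≤_) (lem₂ Q A P B)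
      (0≤-+ (0≤-* (0≤-square Q) h₁) (0≤-+ (0≤-+ (0≤-+ (0≤-+ (0≤-* (0≤+ 5) (0≤-square (Q * A))) (0≤-* (0≤+ 5) (0≤-* hu hδ))) (0≤-* (0≤+ 5) (0≤-* hu hw))) (0≤-square w))
        (0≤-* (0≤+ 2) (0≤-* hδ hw)))))))
    where
    w = Q * B - + 2 * (Q * A) - (P * B - Q * A)
    hu : 0ℤ ℤ.≤ Q * A
    hu = 0≤-* hQ hA
    hδ : 0ℤ ℤ.≤ P * B - Q * A
    hδ = subst (0ℤ ℤ.≤_) (sym eq) (0≤+ (suc k))
    hw : 0ℤ ℤ.≤ w
    hw = 0≤-cancel k (subst (λ δ → 0ℤ ℤ.≤ δ * w) eq (subst (0ℤ ℤ.≤_) (lem₁ Q A P B) (0≤-+ (0≤-* (0≤-square Q) h₁) (0≤-* (0≤-square B) h₂))))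
    absurd : ¬ (0ℤ ℤ.≤ - (+ suc k * + suc k))
    absurd ()

-- The inequality between h (x²) and x h (x)

ln-mono : ∀ p q .{{_ : NonZero p}} .{{_ : NonZero q}} → p ℕ.≤ q → Pos (λ M → ln q M - ln p M)
ln-mono p q p≤q = Pos-cancel-* (0<+ q) (Pos-cong (λ M → lem (+ p) (+ q) (+ suc M) (ln p M) (ln q M))
  (ln-tangent p q ⊕ Pos-*𝟙 (i≤j⇒0≤j-i (+≤+ p≤q))))
  where
  lem : ∀ p q m a b → ((p - q) * m - q * (a - b)) + (q - p) * m ≡ q * (b - a)
  lem = solve-∀

H-nonneg : ∀ u v → Pos (H u v)
H-nonneg u v = Pos-cong (λ M → lem (+ u) (+ v) (ln (u ℕ.+ v) M) (ln u M) (ln v M)) (part u v ⊕ subst (λ n → Pos (λ M → + v * (ln n M - ln v M))) (ℕ.+-comm v u) (part v u))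
  where
  lem : ∀ u v c a b → u * (c - a) + v * (c - b) ≡ (u + v) * c - u * a - v * b
  lem = solve-∀
  part : ∀ u v → Pos (λ M → + u * (ln (u ℕ.+ v) M - ln u M))
  part zero v = Pos-nonneg λ M → ≤-reflexive (lem′ (ln (0 ℕ.+ v) M - ln 0 M))
    where
    lem′ : ∀ x → 0ℤ ≡ 0ℤ * x
    lem′ = solve-∀
  part u@(suc _) v = 0≤+ u ⊛ ln-mono u (u ℕ.+ v) (ℕ.m≤m+n u v)

-- The rational bound at t = 1 / 2.
16ln2≥11 : Pos (λ M → + 16 * ln 2 M - + 11 * 𝟙 M)
16ln2≥11 = Pos-cong (λ M → trans (cong (λ x → (+ 1 - + 2) * (+ 1 + + 5 * + 2) * 𝟙 M - + 2 * (+ 4 * + 1 + + 2 * + 2) * (x - ln 2 M)) (ln-1 M)) (lem (+ suc M) (ln 2 M))) (ln-bound 1 2)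
  where
  lem : ∀ t y → (+ 1 - + 2) * (+ 1 + + 5 * + 2) * t - + 2 * (+ 4 * + 1 + + 2 * + 2) * (0ℤ - y) ≡ + 16 * y - + 11 * t
  lem = solve-∀

module _ (a b P Q : ℕ) .{{_ : NonZero a}} .{{_ : NonZero b}} .{{_ : NonZero Q}}
  (κ≥0 : 0ℤ ℤ.≤ + P * + Q + + Q * + Q - + P * + P) (8P≤13Q : 8 ℕ.* P ℕ.≤ 13 ℕ.* Q) where

  private
    m = a ℕ.+ b
    s = a ℕ.+ m

    instance
      m≢0 : NonZero m
      m≢0 = ℕ.>-nonZero (ℕ.<-≤-trans (ℕ.>-nonZero⁻¹ a) (ℕ.m≤m+n a b))
      s≢0 : NonZero s
      s≢0 = ℕ.>-nonZero (ℕ.<-≤-trans (ℕ.>-nonZero⁻¹ a) (ℕ.m≤m+n a m))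
      mm≢0 : NonZero (m ℕ.* m)
      mm≢0 = ℕ.m*n≢0 m m
      ss≢0 : NonZero (s ℕ.* s)
      ss≢0 = ℕ.m*n≢0 s s
      as≢0 : NonZero (a ℕ.* s)
      as≢0 = ℕ.m*n≢0 a s
      bss≢0 : NonZero (b ℕ.* (s ℕ.* s))
      bss≢0 = ℕ.m*n≢0 b (s ℕ.* s)
      mmm≢0 : NonZero (m ℕ.* (m ℕ.* m))
      mmm≢0 = ℕ.m*n≢0 m (m ℕ.* m)

    13Q-8P≥0 : 0ℤ ℤ.≤ + 13 * + Q - + 8 * + P
    13Q-8P≥0 = subst (0ℤ ℤ.≤_) (cong₂ _-_ (pos-* 13 Q) (pos-* 8 P)) (i≤j⇒0≤j-i (+≤+ 8P≤13Q))

    2Q-P≥0 : 0ℤ ℤ.≤ + 2 * + Q - + P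
    2Q-P≥0 = 0≤-cancel 7 (subst (0ℤ ℤ.≤_) (lem (+ P) (+ Q)) (0≤-+ 13Q-8P≥0 (0≤-* (0≤+ 3) (0≤+ Q))))
      where
      lem : ∀ P Q → (+ 13 * Q - + 8 * P) + + 3 * Q ≡ + 8 * (+ 2 * Q - P)
      lem = solve-∀

    Qs-Pa≥0 : 0ℤ ℤ.≤ + Q * + s - + P * + a
    Qs-Pa≥0 = subst (0ℤ ℤ.≤_) (lem (+ a) (+ b) (+ P) (+ Q)) (0≤-+ (0≤-* 2Q-P≥0 (0≤+ a)) (0≤-* (0≤+ Q) (0≤+ b)))
      where
      lem : ∀ a b P Q → (+ 2 * Q - P) * a + Q * b ≡ Q * (a + (a + b)) - P * a
      lem = solve-∀

    -- Q (m - φ a)² if P / Q = φ, because 1 + φ = φ²; in general Q Π = (Q m - P a)² + (P Q + Q² -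
    -- P²) a².
    Π = + Q * (+ m * + m) - + 2 * (+ P * (+ a * + m)) + (+ Q + + P) * (+ a * + a)

    Π≥0 : 0ℤ ℤ.≤ Π
    Π≥0 = cancel Q (subst (0ℤ ℤ.≤_) (lem (+ a) (+ m) (+ P) (+ Q)) (0≤-+ (0≤-square (+ Q * + m - + P * + a)) (0≤-* κ≥0 (0≤-square (+ a)))))
      where
      cancel : ∀ n .{{_ : NonZero n}} {x} → 0ℤ ℤ.≤ + n * x → 0ℤ ℤ.≤ x
      cancel (suc n) = 0≤-cancel n
      lem : ∀ a m P Q → (Q * m - P * a) * (Q * m - P * a) + (P * Q + Q * Q - P * P) * (a * a)
        ≡ Q * (Q * (m * m) - + 2 * (P * (a * m)) + (Q + P) * (a * a))
      lem = solve-∀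

    e  = ⟦ 𝔢 ⟧ (+ a) (+ b)
    u  = ⟦ 𝔲 ⟧ (+ a) (+ b)
    w  = ⟦ 𝔴 ⟧ (+ a) (+ b)
    D₁ = ⟦ 𝔻₁ ⟧ (+ a) (+ b)
    D₂ = ⟦ 𝔻₂ ⟧ (+ a) (+ b)
    D₃ = ⟦ 𝔻₃ ⟧ (+ a) (+ b)

    -- x (1 + x) and (1 - x) (1 + x)² for x = a / m, both equal to 1 at x = 1 / φ
    ln-t₂ ln-t₃ : ℕ → ℤ
    ln-t₂ M = ln a M + ln s M - + 2 * ln m M
    ln-t₃ M = ln b M + + 2 * ln s M - + 3 * ln m M

    -- The rational bound is taken at m / s = 1 / (1 + x), so that it bounds log (1 + x) from below.
    bound₁ : Pos (λ M → (+ m - + s) * (+ 5 * + s + + m) * 𝟙 M + + 2 * D₁ * (ln s M - ln m M))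
    bound₁ = Pos-cong (λ M → lem (+ m) (+ s) (+ suc M) (ln m M) (ln s M)) (ln-bound m s)
      where
      lem : ∀ m s t l k → (m - s) * (m + + 5 * s) * t - s * (+ 4 * m + + 2 * s) * (l - k) ≡ (m - s) * (+ 5 * s + m) * t + + 2 * (s * (+ 2 * m + s)) * (k - l)
      lem = solve-∀

    mid : ∀ p q P Q → + p ≡ P → + q ≡ Q → .{{_ : NonZero p}} .{{_ : NonZero q}} →
      Pos (λ M → (P - Q) * (P + + 5 * Q) * 𝟙 M - Q * (+ 4 * P + + 2 * Q) * (ln p M - ln q M))
    mid p q _ _ refl refl = ln-bound p q

    -- t₂ - 1 = - (1 - x - x²), and in `bound₃` t₃ - 1 = x (1 - x - x²): both rational bounds carry
    -- the factor `e` and vanish at x = 1 / φ.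
    bound₂ : Pos (λ M → (- e) * u * 𝟙 M - + 2 * (+ m * + m) * D₂ * ln-t₂ M)
    bound₂ = Pos-cong (λ M → lem (+ a) (+ m) (+ s) (+ suc M) (ln a M) (ln m M) (ln s M) (ln (a ℕ.* s) M) (ln (m ℕ.* m) M))
      ( mid (a ℕ.* s) (m ℕ.* m) (+ a * + s) (+ m * + m) (pos-* a s) (pos-* m m)
      ⊕ 0≤-* (0≤-square (+ m)) (0≤-+ (0≤-* (0≤+ 4) (0≤-* (0≤+ a) (0≤+ s))) (0≤-* (0≤+ 2) (0≤-square (+ m)))) ⊛ (ln-*-≥ a s ⊕ ln-*-≤ m m))
      where
      lem : ∀ a m s t la lm ls las lmm →
        (a * s - m * m) * (a * s + + 5 * (m * m)) * t - m * m * (+ 4 * (a * s) + + 2 * (m * m)) * (las - lmm)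
        + (m * m * (+ 4 * (a * s) + + 2 * (m * m))) * ((las - (la + ls)) + (lm + lm - lmm))
        ≡ (- (m * m - a * s)) * (a * s + + 5 * (m * m)) * t - + 2 * (m * m) * (+ 2 * (a * s) + m * m) * (la + ls - + 2 * lm)
      lem = solve-∀

    bound₃ : Pos (λ M → + a * e * w * 𝟙 M - + 2 * (+ m * + m * + m) * D₃ * ln-t₃ M)
    bound₃ = Pos-cong (λ M → trans (lem (+ m) (+ s) (+ b) (+ suc M) (ln b M) (ln m M) (ln s M) (ln (s ℕ.* s) M) (ln (m ℕ.* m) M) (ln (b ℕ.* (s ℕ.* s)) M) (ln (m ℕ.* (m ℕ.* m)) M))
        (cong (λ x → x * w * 𝟙 M - + 2 * (+ m * + m * + m) * D₃ * ln-t₃ M) (lem′ (+ a) (+ b))))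
      ( mid (b ℕ.* (s ℕ.* s)) (m ℕ.* (m ℕ.* m)) (+ b * (+ s * + s)) (+ m * + m * + m)
          (trans (pos-* b (s ℕ.* s)) (cong (+ b *_) (pos-* s s))) (trans (trans (pos-* m (m ℕ.* m)) (cong (+ m *_) (pos-* m m))) (assoc (+ m)))
      ⊕ 0≤-* mmm≥0 (0≤-+ (0≤-* (0≤+ 4) (0≤-* (0≤+ b) (0≤-square (+ s)))) (0≤-* (0≤+ 2) mmm≥0)) ⊛
        (ln-*-≥ b (s ℕ.* s) ⊕ ln-*-≥ s s ⊕ ln-*-≤ m (m ℕ.* m) ⊕ ln-*-≤ m m))
      where
      mmm≥0 : 0ℤ ℤ.≤ + m * + m * + m
      mmm≥0 = 0≤-* (0≤-square (+ m)) (0≤+ m)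
      assoc : ∀ m → m * (m * m) ≡ m * m * m
      assoc = solve-∀
      lem′ : ∀ a b → b * ((a + (a + b)) * (a + (a + b))) - (a + b) * (a + b) * (a + b) ≡ a * ((a + b) * (a + b) - a * (a + (a + b)))
      lem′ = solve-∀
      lem : ∀ m s b t lb lm ls lss lmm lbss lmmm →
        (b * (s * s) - m * m * m) * (b * (s * s) + + 5 * (m * m * m)) * t - m * m * m * (+ 4 * (b * (s * s)) + + 2 * (m * m * m)) * (lbss - lmmm)
        + (m * m * m * (+ 4 * (b * (s * s)) + + 2 * (m * m * m))) * ((lbss - (lb + lss)) + (lss - (ls + ls)) + (lm + lmm - lmmm) + (lm + lm - lmm))
        ≡ (b * (s * s) - m * m * m) * (b * (s * s) + + 5 * (m * m * m)) * t - + 2 * (m * m * m) * (+ 2 * (b * (s * s)) + m * m * m) * (lb + + 2 * ls - + 3 * lm)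
      lem = solve-∀

    eq-m : a ℕ.* a ℕ.+ b ℕ.* s ≡ m ℕ.* m
    eq-m = lem a b
      where
      lem : ∀ a b → a ℕ.* a ℕ.+ b ℕ.* (a ℕ.+ (a ℕ.+ b)) ≡ (a ℕ.+ b) ℕ.* (a ℕ.+ b)
      lem = ℕ-Ring.solve-∀

    -- The factorisation 1 - x² = (1 - x) (1 + x) reduces all logarithms to those of `a`, `b`, `m`
    -- and `s`.
    H-square : Pos (λ M → H (a ℕ.* a) (b ℕ.* s) M - (+ 2 * (+ m * + m) * ln m M - + 2 * (+ a * + a) * ln a M - + b * + s * (ln b M + ln s M)))
    H-square = Pos-cong (λ M → trans (lem (+ a) (+ b) (+ m) (+ s) (ln a M) (ln b M) (ln m M) (ln s M) (ln (m ℕ.* m) M) (ln (a ℕ.* a) M) (ln (b ℕ.* s) M))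
        (cong (_- (+ 2 * (+ m * + m) * ln m M - + 2 * (+ a * + a) * ln a M - + b * + s * (ln b M + ln s M)))
          (trans (cong₂ _-_ (cong₂ (λ x y → x * ln (m ℕ.* m) M - y * ln (a ℕ.* a) M) (sym (pos-* m m)) (sym (pos-* a a))) (cong (_* ln (b ℕ.* s) M) (sym (pos-* b s))))
            (sym (H-≡ (a ℕ.* a) (b ℕ.* s) (m ℕ.* m) eq-m M)))))
      (0≤-square (+ m) ⊛ ln-*-≥ m m ⊕ 0≤-square (+ a) ⊛ ln-*-≤ a a ⊕ 0≤-* (0≤+ b) (0≤+ s) ⊛ ln-*-≤ b s)
      where
      lem : ∀ a b m s la lb lm ls lmm laa lbs → m * m * (lmm - (lm + lm)) + a * a * (la + la - laa) + b * s * (lb + ls - lbs)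
        ≡ (m * m * lmm - a * a * laa - b * s * lbs) - (+ 2 * (m * m) * lm - + 2 * (a * a) * la - b * s * (lb + ls))
      lem = solve-∀

  private
    constant : ℤ
    constant = Π * (+ m * + m * + m) * (D₂ * D₃) * ((+ s - + m) * (+ 5 * + s + + m))
      + (+ 2 * + Q - + P) * (+ a * + a) * + m * (D₁ * D₃) * (e * u)
      - + b * (+ Q * + s - + P * + a) * (D₁ * D₂) * (+ a * e * w)

    -- `constant` is what the three bounds leave once the logarithms cancel. It is linear in P and
    -- Q, and `𝔸` and `𝔹` are its coefficients up to sign after the common factor a = s - m is taken
    -- out.
    constant-≡ : + a * (+ Q * ⟦ 𝔸 ⟧ (+ a) (+ b) - + P * ⟦ 𝔹 ⟧ (+ a) (+ b)) ≡ constant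
    constant-≡ = trans (lem (+ a) (+ b) (+ m) (+ s) (+ P) (+ Q) e u w D₁ D₂ D₃ (+ 5 * + s + + m) (+ m * + m * + m))
        (cong (λ x → Π * (+ m * + m * + m) * (D₂ * D₃) * (x * (+ 5 * + s + + m))
      + (+ 2 * + Q - + P) * (+ a * + a) * + m * (D₁ * D₃) * (e * u)
      - + b * (+ Q * + s - + P * + a) * (D₁ * D₂) * (+ a * e * w)) (lem′ (+ a) (+ m)))
      where
      lem′ : ∀ a m → a ≡ (a + m) - m
      lem′ = solve-∀
      lem : ∀ a b m s P Q e u w D₁ D₂ D₃ g n →
        a * (Q * ((m * m + a * a) * (g * n * (D₂ * D₃)) + e * D₁ * (+ 2 * (a * m * u * D₃) - b * s * w * D₂))
           - P * ((+ 2 * (a * m) - a * a) * (g * n * (D₂ * D₃)) + e * D₁ * (a * m * u * D₃ - b * a * w * D₂)))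
        ≡ (Q * (m * m) - + 2 * (P * (a * m)) + (Q + P) * (a * a)) * n * (D₂ * D₃) * (a * g)
          + (+ 2 * Q - P) * (a * a) * m * (D₁ * D₃) * (e * u) - b * (Q * s - P * a) * (D₁ * D₂) * (a * e * w)
      lem = solve-∀

  module _ (a≤16b : a ℕ.≤ 16 ℕ.* b) where
    private
      constant≥0 : 0ℤ ℤ.≤ constant
      constant≥0 = subst (0ℤ ℤ.≤_) constant-≡ (0≤-* (0≤+ a) (golden-≤ {⟦ 𝔸 ⟧ (+ a) (+ b)} {⟦ 𝔹 ⟧ (+ a) (+ b)} {+ P} {+ Q}
        (0≤𝔸 (0≤+ a) (0≤+ b) hz) (0≤+ Q)
        (subst (0ℤ ℤ.≤_) (sym (quadratic (+ a) (+ b))) (0≤-* (0≤-square e) (0≤Ω (0≤+ a) (0≤+ b) hz))) κ≥0))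
        where
        hz : 0ℤ ℤ.≤ ⟦ 𝕫 ⟧ (+ a) (+ b)
        hz = subst (λ x → 0ℤ ℤ.≤ x - + a) (pos-* 16 b) (i≤j⇒0≤j-i (+≤+ a≤16b))

      0≤D₁ : 0ℤ ℤ.≤ D₁
      0≤D₁ = 0≤-form 𝔻₁ _ (0≤+ a) (0≤+ b)
      0≤D₂ : 0ℤ ℤ.≤ D₂
      0≤D₂ = 0≤-form 𝔻₂ _ (0≤+ a) (0≤+ b)
      0≤D₃ : 0ℤ ℤ.≤ D₃
      0≤D₃ = 0≤-form 𝔻₃ _ (0≤+ a) (0≤+ b)
      0<D₁ : 0ℤ ℤ.< D₁
      0<D₁ = 0<-* (0<+ s) (+-mono-<-≤ (0<-* (0<+ 2) (0<+ m)) (0≤+ s))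
      0<mm : 0ℤ ℤ.< + m * + m
      0<mm = 0<-* (0<+ m) (0<+ m)
      0<D₂ : 0ℤ ℤ.< D₂
      0<D₂ = +-mono-≤-< (0≤-* (0≤+ 2) (0≤-* (0≤+ a) (0≤+ s))) 0<mm
      0<D₃ : 0ℤ ℤ.< D₃
      0<D₃ = +-mono-≤-< (0≤-* (0≤+ 2) (0≤-* (0≤+ b) (0≤-square (+ s)))) (0<-* 0<mm (0<+ m))
      0≤m³ : 0ℤ ℤ.≤ + m * + m * + m
      0≤m³ = 0≤-* (0≤-square (+ m)) (0≤+ m)

      -- The left-hand side is m² (h (x²) - (P / Q) x h (x)) Q, written so that Π vanishes at x = 1 / φ if P / Q = φ
      -- and the other two logarithms vanish there as well.
      weighted : Pos (λ M → Π * (ln s M - ln m M) - (+ 2 * + Q - + P) * (+ a * + a) * ln-t₂ M - + b * (+ Q * + s - + P * + a) * ln-t₃ M)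
      weighted = Pos-cancel-* (0<-* (0<-* (0<+ 2) (0<-* 0<mm (0<+ m))) (0<-* 0<D₁ (0<-* 0<D₂ 0<D₃)))
        (Pos-cong (λ M → lem (+ a) (+ b) (+ m) (+ s) Π (+ 2 * + Q - + P) (+ Q * + s - + P * + a) e u w D₁ D₂ D₃ (+ suc M) (ln s M - ln m M) (ln-t₂ M) (ln-t₃ M))
          ( 0≤-* (0≤-* Π≥0 0≤m³) (0≤-* 0≤D₂ 0≤D₃) ⊛ bound₁
          ⊕ 0≤-* (0≤-* (0≤-* 2Q-P≥0 (0≤-square (+ a))) (0≤+ m)) (0≤-* 0≤D₁ 0≤D₃) ⊛ bound₂
          ⊕ 0≤-* (0≤-* (0≤+ b) Qs-Pa≥0) (0≤-* 0≤D₁ 0≤D₂) ⊛ bound₃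
          ⊕ Pos-*𝟙 constant≥0))
        where
        lem : ∀ a b m s Π R S e u w D₁ D₂ D₃ t X₁ X₂ X₃ →
          (Π * (m * m * m) * (D₂ * D₃)) * ((m - s) * (+ 5 * s + m) * t + + 2 * D₁ * X₁)
          + (R * (a * a) * m * (D₁ * D₃)) * ((- e) * u * t - + 2 * (m * m) * D₂ * X₂)
          + (b * S * (D₁ * D₂)) * (a * e * w * t - + 2 * (m * m * m) * D₃ * X₃)
          + (Π * (m * m * m) * (D₂ * D₃) * ((s - m) * (+ 5 * s + m)) + R * (a * a) * m * (D₁ * D₃) * (e * u) - b * S * (D₁ * D₂) * (a * e * w)) * t
          ≡ (+ 2 * (m * m * m) * (D₁ * (D₂ * D₃))) * (Π * X₁ - R * (a * a) * X₂ - b * S * X₃)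
        lem = solve-∀

    H-square-bound-small : Pos (λ M → + Q * H (a ℕ.* a) (b ℕ.* s) M - + P * (+ a * H a b M))
    H-square-bound-small = Pos-cong (λ M → lem (+ a) (+ b) (+ P) (+ Q) (ln a M) (ln b M) (ln m M) (ln s M) (H (a ℕ.* a) (b ℕ.* s) M))
      (weighted ⊕ 0≤+ Q ⊛ H-square)
      where
      lem : ∀ a b P Q la lb lm ls h → let m = a + b ; s = a + m in
        ((Q * (m * m) - + 2 * (P * (a * m)) + (Q + P) * (a * a)) * (ls - lm) - (+ 2 * Q - P) * (a * a) * (la + ls - + 2 * lm) - b * (Q * s - P * a) * (lb + + 2 * ls - + 3 * lm))
        + Q * (h - (+ 2 * (m * m) * lm - + 2 * (a * a) * la - b * s * (lb + ls)))
        ≡ Q * h - P * (a * (m * lm - a * la - b * lb))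
      lem = solve-∀

  module _ (16b≤a : 16 ℕ.* b ℕ.≤ a) where
    private
      10ln2≤7 : Pos (λ M → + 7 * 𝟙 M - + 10 * ln 2 M)
      10ln2≤7 = Pos-cong (λ M → trans (cong (λ x → (+ 2 - + 1) * (+ 2 + + 5 * + 1) * 𝟙 M - + 1 * (+ 4 * + 2 + + 2 * + 1) * (ln 2 M - x)) (ln-1 M)) (lem (+ suc M) (ln 2 M))) (ln-bound 2 1)
        where
        lem : ∀ t y → (+ 2 - + 1) * (+ 2 + + 5 * + 1) * t - + 1 * (+ 4 * + 2 + + 2 * + 1) * (y - 0ℤ) ≡ + 7 * t - + 10 * y
        lem = solve-∀

      s≤2m : s ℕ.≤ 2 ℕ.* m
      s≤2m = ℕ.≤-trans (ℕ.+-monoˡ-≤ m (ℕ.m≤m+n a b)) (ℕ.≤-reflexive (lem m))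
        where
        lem : ∀ m → m ℕ.+ m ≡ 2 ℕ.* m
        lem = ℕ-Ring.solve-∀

      instance
        2m≢0 : NonZero (2 ℕ.* m)
        2m≢0 = ℕ.m*n≢0 2 m
        16b≢0 : NonZero (16 ℕ.* b)
        16b≢0 = ℕ.m*n≢0 16 b

      α β γ : ℕ → ℤ
      α M = ln m M - ln a M
      β M = ln m M - ln b M
      γ M = ln s M - ln m M

      α-bound : Pos (λ M → + m * α M - + b * 𝟙 M)
      α-bound = Pos-cong (λ M → lem (+ a) (+ b) (+ suc M) (ln a M) (ln m M)) (ln-tangent a m)
        where
        lem : ∀ a b t la lm → (a - (a + b)) * t - (a + b) * (la - lm) ≡ (a + b) * (lm - la) - b * t
        lem = solve-∀
      β-bound : Pos (λ M → + 4 * β M - + 11 * 𝟙 M)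
      β-bound = Pos-cong (λ M → lem (+ suc M) (ln m M) (ln b M) (ln 2 M) (ln 4 M) (ln 8 M) (ln 16 M) (ln (16 ℕ.* b) M))
        ( 0≤+ 4 ⊛ (ln-mono (16 ℕ.* b) m (ℕ.≤-trans 16b≤a (ℕ.m≤m+n a b)) ⊕ ln-*-≥ 16 b ⊕ ln-*-≥ 2 8 ⊕ ln-*-≥ 2 4 ⊕ ln-*-≥ 2 2)
        ⊕ 16ln2≥11)
        where
        lem : ∀ t lm lb l₂ l₄ l₈ l₁₆ l → + 4 * ((lm - l) + (l - (l₁₆ + lb)) + (l₁₆ - (l₂ + l₈)) + (l₈ - (l₂ + l₄)) + (l₄ - (l₂ + l₂))) + (+ 16 * l₂ - + 11 * t)
          ≡ + 4 * (lm - lb) - + 11 * t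
        lem = solve-∀
      γ-bound : Pos (λ M → + 7 * 𝟙 M - + 10 * γ M)
      γ-bound = Pos-cong (λ M → lem (+ suc M) (ln s M) (ln m M) (ln 2 M) (ln (2 ℕ.* m) M))
        (0≤+ 10 ⊛ (ln-mono s (2 ℕ.* m) s≤2m ⊕ ln-*-≤ 2 m) ⊕ 10ln2≤7)
        where
        lem : ∀ t ls lm l₂ l → + 10 * ((l - ls) + (l₂ + lm - l)) + (+ 7 * t - + 10 * l₂) ≡ + 7 * t - + 10 * (ls - lm)
        lem = solve-∀

      -- The left-hand side is m² (8 h (x²) - 13 x h (x)): away from 1 / φ the cruder ratio 13 / 8 >
      -- φ suffices. With α ≥ b / m, β ≥ log 16 ≥ 11 / 4 and γ ≤ log 2 ≤ 7 / 10 the leading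
      -- coefficient as x → 1 is 3 + 33 / 4 - 56 / 5 = 1 / 20. The threshold 16 is a power of two,
      -- so that log 2 alone has to be estimated.
      weighted : Pos (λ M → + 3 * (+ a * + a) * α M + + b * (+ 3 * + a + + 8 * + b) * β M - + 8 * (+ b * + s) * γ M)
      weighted = Pos-cancel-* (0<-* (0<+ 20) (0<+ m)) (Pos-cong (λ M → lem (+ a) (+ b) (+ suc M) (α M) (β M) (γ M))
        ( 0≤-* (0≤+ 60) (0≤-square (+ a)) ⊛ α-bound
        ⊕ 0≤-* (0≤-* (0≤+ 5) (0≤+ m)) (0≤-* (0≤+ b) (0≤-+ (0≤-* (0≤+ 3) (0≤+ a)) (0≤-* (0≤+ 8) (0≤+ b)))) ⊛ β-bound
        ⊕ 0≤-* (0≤-* (0≤+ 16) (0≤+ m)) (0≤-* (0≤+ b) (0≤+ s)) ⊛ γ-bound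
        ⊕ Pos-*𝟙 (0≤-* (0≤+ b) (0≤-+ (0≤-+ (0≤-square (+ a)) (0≤-* (0≤+ 269) (0≤-* (0≤+ a) (0≤+ b)))) (0≤-* (0≤+ 328) (0≤-square (+ b)))))))
        where
        lem : ∀ a b t α β γ →
          (+ 60 * (a * a)) * ((a + b) * α - b * t) + (+ 5 * (a + b) * (b * (+ 3 * a + + 8 * b))) * (+ 4 * β - + 11 * t)
          + (+ 16 * (a + b) * (b * (a + (a + b)))) * (+ 7 * t - + 10 * γ)
          + b * (a * a + + 269 * (a * b) + + 328 * (b * b)) * t
          ≡ (+ 20 * (a + b)) * (+ 3 * (a * a) * α + b * (+ 3 * a + + 8 * b) * β - + 8 * (b * (a + (a + b))) * γ)
        lem = solve-∀

    H-square-bound-large : Pos (λ M → + Q * H (a ℕ.* a) (b ℕ.* s) M - + P * (+ a * H a b M))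
    H-square-bound-large = Pos-cancel 7 (Pos-cong (λ M → lem (+ a) (+ b) (+ P) (+ Q) (ln a M) (ln b M) (ln m M) (ln s M) (H (a ℕ.* a) (b ℕ.* s) M))
      ( 0≤+ Q ⊛ weighted
      ⊕ 0≤-* (0≤+ 8) (0≤+ Q) ⊛ H-square
      ⊕ 0≤-* 13Q-8P≥0 (0≤+ a) ⊛ H-nonneg a b))
      where
      lem : ∀ a b P Q la lb lm ls h → let m = a + b ; s = a + m in
        Q * (+ 3 * (a * a) * (lm - la) + b * (+ 3 * a + + 8 * b) * (lm - lb) - + 8 * (b * s) * (ls - lm))
        + (+ 8 * Q) * (h - (+ 2 * (m * m) * lm - + 2 * (a * a) * la - b * s * (lb + ls)))
        + ((+ 13 * Q - + 8 * P) * a) * (m * lm - a * la - b * lb)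
        ≡ + 8 * (Q * h - P * (a * (m * lm - a * la - b * lb)))
      lem = solve-∀

  -- With x = a / (a + b), h the binary entropy and P / Q ≤ φ: h (x²) ≥ (P / Q) x h (x).
  H-square-bound : Pos (λ M → + Q * H (a ℕ.* a) (b ℕ.* s) M - + P * (+ a * H a b M))
  H-square-bound with ℕ.≤-total a (16 ℕ.* b)
  ... | inj₁ le = H-square-bound-small le
  ... | inj₂ ge = H-square-bound-large ge

-- The product inequality for the binary entropy

0≡0* : ∀ x → 0ℤ ≡ 0ℤ * x
0≡0* = solve-∀

H-0ˡ : ∀ v M → H 0 v M ≡ 0ℤ
H-0ˡ v M = lem (n-ln v M) (ln 0 M)
  where
  lem : ∀ x y → x - 0ℤ * y - x ≡ 0ℤ
  lem = solve-∀

H-0ʳ : ∀ u M → H u 0 M ≡ 0ℤ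
H-0ʳ u M = trans (cong (λ n → n-ln n M - n-ln u M - n-ln 0 M) (ℕ.+-identityʳ u)) (lem (n-ln u M) (ln 0 M))
  where
  lem : ∀ x y → x - x - 0ℤ * y ≡ 0ℤ
  lem = solve-∀

module _ (P Q : ℕ) .{{_ : NonZero Q}} (κ≥0 : 0ℤ ℤ.≤ + P * + Q + + Q * + Q - + P * + P) (8P≤13Q : 8 ℕ.* P ℕ.≤ 13 ℕ.* Q) where

  H-square-bound′ : ∀ a b .{{_ : NonZero a}} → Pos (λ M → + Q * H (a ℕ.* a) (b ℕ.* (a ℕ.+ (a ℕ.+ b))) M - + P * (+ a * H a b M))
  H-square-bound′ a zero = Pos-nonneg λ M → ≤-reflexive (trans (lem (+ P) (+ Q) (+ a))
      (cong₂ (λ x y → + Q * x - + P * (+ a * y)) (sym (H-0ʳ (a ℕ.* a) M)) (sym (H-0ʳ a M))))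
    where
    lem : ∀ P Q a → 0ℤ ≡ Q * 0ℤ - P * (a * 0ℤ)
    lem = solve-∀
  H-square-bound′ a b@(suc _) = H-square-bound a b P Q κ≥0 8P≤13Q

  -- 2 h (x y) ≥ (P / Q) (x h (y) + y h (x)) for x = a / (a + a′) and y = b / (b + b′)
  H-product-bound : ∀ a a′ b b′ → Pos (λ M → + 2 * + Q * H (a ℕ.* b) (a ℕ.* b′ ℕ.+ a′ ℕ.* b ℕ.+ a′ ℕ.* b′) M - + P * (+ a * H b b′ M + + b * H a a′ M))
  H-product-bound zero a′ b b′ = Pos-nonneg λ M → ≤-reflexive (trans (lem (+ P) (+ Q) (+ b) (H b b′ M))
      (cong₂ (λ x y → + 2 * + Q * x - + P * (0ℤ * H b b′ M + + b * y)) (sym (H-0ˡ (0 ℕ.+ a′ ℕ.* b ℕ.+ a′ ℕ.* b′) M)) (sym (H-0ˡ a′ M))))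
    where
    lem : ∀ P Q b x → 0ℤ ≡ + 2 * Q * 0ℤ - P * (0ℤ * x + b * 0ℤ)
    lem = solve-∀
  H-product-bound a@(suc _) a′ zero b′ = Pos-nonneg λ M → ≤-reflexive (trans (lem (+ P) (+ Q) (+ a) (H a a′ M))
      (cong₂ (λ x y → + 2 * + Q * x - + P * (+ a * y + 0ℤ * H a a′ M))
        (trans (sym (H-0ˡ (a ℕ.* b′ ℕ.+ a′ ℕ.* 0 ℕ.+ a′ ℕ.* b′) M)) (cong (λ n → H n (a ℕ.* b′ ℕ.+ a′ ℕ.* 0 ℕ.+ a′ ℕ.* b′) M) (sym (ℕ.*-zeroʳ a)))) (sym (H-0ˡ b′ M))))
    where
    lem : ∀ P Q a x → 0ℤ ≡ + 2 * Q * 0ℤ - P * (a * 0ℤ + 0ℤ * x)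
    lem = solve-∀
  H-product-bound a@(suc _) a′ b@(suc _) b′ with a ℕ.* b′ ℕ.+ a′ ℕ.* b ℕ.+ a′ ℕ.* b′ in eq
  ... | zero = Pos-nonneg λ M → ≤-reflexive (trans (lem (+ P) (+ Q) (+ a) (+ b))
      (cong₂ (λ x y → + 2 * + Q * x - + P * y) (sym (H-0ʳ (a ℕ.* b) M))
        (cong₂ (λ x y → + a * x + + b * y) (trans (sym (H-0ʳ b M)) (cong (λ n → H b n M) (sym b′≡0))) (trans (sym (H-0ʳ a M)) (cong (λ n → H a n M) (sym a′≡0))))))
    where
    lem : ∀ P Q a b → 0ℤ ≡ + 2 * Q * 0ℤ - P * (a * 0ℤ + b * 0ℤ)
    lem = solve-∀
    b′≡0 : b′ ≡ 0
    b′≡0 = ℕ.m*n≡0⇒m≡0 b′ a (trans (ℕ.*-comm b′ a) (ℕ.m+n≡0⇒m≡0 (a ℕ.* b′) (ℕ.m+n≡0⇒m≡0 (a ℕ.* b′ ℕ.+ a′ ℕ.* b) eq)))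
    a′≡0 : a′ ≡ 0
    a′≡0 = ℕ.m*n≡0⇒m≡0 a′ b (ℕ.m+n≡0⇒n≡0 (a ℕ.* b′) (ℕ.m+n≡0⇒m≡0 (a ℕ.* b′ ℕ.+ a′ ℕ.* b) eq))
  ... | r@(suc _) = Pos-cancel-* (0<-* (0<+ a) (0<+ b)) (Pos-cong (λ M → lem (+ P) (+ Q) (+ a) (+ b) (H a a′ M) (H b b′ M)
        (H (a ℕ.* a) (a′ ℕ.* (a ℕ.+ (a ℕ.+ a′))) M) (H (b ℕ.* b) (b′ ℕ.* (b ℕ.+ (b ℕ.+ b′))) M) (H (a ℕ.* b) r M))
      ( 0≤+ Q ⊛ H-concave a (a ℕ.+ a′) b (b ℕ.+ b′) r (a′ ℕ.* (a ℕ.+ (a ℕ.+ a′))) (b′ ℕ.* (b ℕ.+ (b ℕ.+ b′)))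
          (trans (cong (a ℕ.* b ℕ.+_) (sym eq)) (product a a′ b b′)) (square a a′) (square b b′)
      ⊕ 0≤-square (+ b) ⊛ H-square-bound′ a a′
      ⊕ 0≤-square (+ a) ⊛ H-square-bound′ b b′))
    where
    product : ∀ a a′ b b′ → a ℕ.* b ℕ.+ (a ℕ.* b′ ℕ.+ a′ ℕ.* b ℕ.+ a′ ℕ.* b′) ≡ (a ℕ.+ a′) ℕ.* (b ℕ.+ b′)
    product = ℕ-Ring.solve-∀
    square : ∀ a a′ → a ℕ.* a ℕ.+ a′ ℕ.* (a ℕ.+ (a ℕ.+ a′)) ≡ (a ℕ.+ a′) ℕ.* (a ℕ.+ a′)
    square = ℕ-Ring.solve-∀
    lem : ∀ P Q a b ha hb h₁ h₂ h → Q * (+ 2 * (a * b) * h - b * b * h₁ - a * a * h₂) + b * b * (Q * h₁ - P * (a * ha)) + a * a * (Q * h₂ - P * (b * hb))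
      ≡ a * b * (+ 2 * Q * h - P * (a * hb + b * ha))
    lem = solve-∀

-- Entropy of weighted families

Weight : ℕ → Set
Weight n = Subset n → ℕ

off on : ∀ {n} → Weight (suc n) → Weight n
off f S = f (outside ∷ S)
on  f S = f (inside ∷ S)

total : ∀ {n} → Weight n → ℕ
total {zero}  f = f []
total {suc n} f = total (off f) ℕ.+ total (on f)

cross : ∀ {n} → Weight n → Weight n → ℕ → ℤ
cross {zero}  w f M = + w [] * ln (f []) M
cross {suc n} w f M = cross (off w) (off f) M + cross (on w) (on f) M

-- Ent w is total w times the entropy of the distribution w / total w.
Ent : ∀ {n} → Weight n → ℕ → ℤ
Ent w M = n-ln (total w) M - cross w w M

infixl 6 _⊎ʷ_
_⊎ʷ_ : ∀ {n} → Weight n → Weight n → Weight n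
(v ⊎ʷ w) S = v S ℕ.+ w S

total-+ : ∀ {n} (v w : Weight n) → total (v ⊎ʷ w) ≡ total v ℕ.+ total w
total-+ {zero}  v w = refl
total-+ {suc n} v w = trans (cong₂ ℕ._+_ (total-+ (off v) (off w)) (total-+ (on v) (on w)))
  (lem (total (off v)) (total (off w)) (total (on v)) (total (on w)))
  where
  lem : ∀ a b c d → a ℕ.+ b ℕ.+ (c ℕ.+ d) ≡ a ℕ.+ c ℕ.+ (b ℕ.+ d)
  lem = ℕ-Ring.solve-∀

cross-+ : ∀ {n} (v w f : Weight n) M → cross (v ⊎ʷ w) f M ≡ cross v f M + cross w f M
cross-+ {zero} v w f M = lem (+ v []) (+ w []) (ln (f []) M)
  where
  lem : ∀ a b x → (a + b) * x ≡ a * x + b * x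
  lem = solve-∀
cross-+ {suc n} v w f M = trans (cong₂ _+_ (cross-+ (off v) (off w) (off f) M) (cross-+ (on v) (on w) (on f) M))
  (lem (cross (off v) (off f) M) (cross (off w) (off f) M) (cross (on v) (on f) M) (cross (on w) (on f) M))
  where
  lem : ∀ a b c d → a + b + (c + d) ≡ a + c + (b + d)
  lem = solve-∀

cross-null : ∀ {n} (w f : Weight n) M → total w ≡ 0 → cross w f M ≡ 0ℤ
cross-null {zero} w f M eq = trans (cong (λ n → + n * ln (f []) M) eq) (sym (0≡0* (ln (f []) M)))
cross-null {suc n} w f M eq = cong₂ _+_ (cross-null (off w) (off f) M (ℕ.m+n≡0⇒m≡0 (total (off w)) eq)) (cross-null (on w) (on f) M (ℕ.m+n≡0⇒n≡0 (total (off w)) eq))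

infix 4 _≪_
-- Absolute continuity. As `ln 0` is 0 and not - ∞, it excludes terms w log f that would be read as
-- 0 wrongly.
_≪_ : ∀ {n} → Weight n → Weight n → Set
w ≪ f = ∀ S → f S ≡ 0 → w S ≡ 0

total-≪ : ∀ {n} (w f : Weight n) → w ≪ f → total f ≡ 0 → total w ≡ 0
total-≪ {zero} w f w≪f eq = w≪f [] eq
total-≪ {suc n} w f w≪f eq = cong₂ ℕ._+_ (total-≪ (off w) (off f) (λ S → w≪f (outside ∷ S)) (ℕ.m+n≡0⇒m≡0 (total (off f)) eq))
  (total-≪ (on w) (on f) (λ S → w≪f (inside ∷ S)) (ℕ.m+n≡0⇒n≡0 (total (off f)) eq))

module _ (W T : ℕ) .{{_ : NonZero W}} .{{_ : NonZero T}} where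

  -- log t ≤ t - 1 at t = f W / (w T). Summed over all sets, the linear part T w - W f cancels when
  -- W and T are the totals.
  gibbs-term : ∀ w f → (f ≡ 0 → w ≡ 0) →
    Pos (λ M → + T * (+ w * ln w M - + w * ln f M + + w * (ln T M - ln W M)) - (+ T * + w - + W * + f) * 𝟙 M)
  gibbs-term zero f _ = Pos-cong (λ M → lem (+ T) (+ W) (+ f) (+ suc M) (ln 0 M) (ln f M) (ln T M - ln W M)) (Pos-*𝟙 (0≤-* (0≤+ W) (0≤+ f)))
    where
    lem : ∀ T W f t x y z → W * f * t ≡ T * (0ℤ * x - 0ℤ * y + 0ℤ * z) - (T * 0ℤ - W * f) * t
    lem = solve-∀
  gibbs-term (suc _) zero h with h refl
  ... | ()
  gibbs-term w@(suc _) f@(suc _) _ = Pos-cong (λ M → trans (cong₂ (λ x y → (x - y) * 𝟙 M - y * (ln (f ℕ.* W) M - ln (w ℕ.* T) M)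
        + (+ w * + T) * ((ln (f ℕ.* W) M - (ln f M + ln W M)) + (ln w M + ln T M - ln (w ℕ.* T) M))) (pos-* f W) (pos-* w T))
        (lem (+ w) (+ f) (+ W) (+ T) (+ suc M) (ln w M) (ln f M) (ln W M) (ln T M) (ln (f ℕ.* W) M) (ln (w ℕ.* T) M)))
    ( ln-tangent (f ℕ.* W) (w ℕ.* T) {{ℕ.m*n≢0 f W}} {{ℕ.m*n≢0 w T}}
    ⊕ 0≤-* (0≤+ w) (0≤+ T) ⊛ (ln-*-≥ f W ⊕ ln-*-≤ w T))
    where
    lem : ∀ w f W T t lw lf lW lT x y → (f * W - w * T) * t - w * T * (x - y) + (w * T) * ((x - (lf + lW)) + (lw + lT - y))
      ≡ T * (w * lw - w * lf + w * (lT - lW)) - (T * w - W * f) * t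
    lem = solve-∀

  gibbs-sum : ∀ {n} (w f : Weight n) → w ≪ f →
    Pos (λ M → + T * (cross w w M - cross w f M + + total w * (ln T M - ln W M)) - (+ T * + total w - + W * + total f) * 𝟙 M)
  gibbs-sum {zero} w f w≪f = gibbs-term (w []) (f []) (w≪f [])
  gibbs-sum {suc n} w f w≪f = Pos-cong (λ M → lem (+ T) (+ W) (+ suc M) (ln T M - ln W M) (cross (off w) (off w) M) (cross (off w) (off f) M) (+ total (off w)) (+ total (off f))
      (cross (on w) (on w) M) (cross (on w) (on f) M) (+ total (on w)) (+ total (on f)))
    (gibbs-sum (off w) (off f) (λ S → w≪f (outside ∷ S)) ⊕ gibbs-sum (on w) (on f) (λ S → w≪f (inside ∷ S)))
    where
    lem : ∀ T W t l a b c d a′ b′ c′ d′ → (T * (a - b + c * l) - (T * c - W * d) * t) + (T * (a′ - b′ + c′ * l) - (T * c′ - W * d′) * t)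
      ≡ T * ((a + a′) - (b + b′) + (c + c′) * l) - (T * (c + c′) - W * (d + d′)) * t
    lem = solve-∀

gibbs : ∀ {n} (w f : Weight n) → w ≪ f → Pos (λ M → cross w w M - cross w f M - + total w * (ln (total w) M - ln (total f) M))
gibbs w f w≪f with total w in eqw | total f in eqf
... | zero | T = Pos-nonneg λ M → ≤-reflexive (trans (lem (ln 0 M - ln T M))
    (cong₂ (λ x y → x - y - 0ℤ * (ln 0 M - ln T M)) (sym (cross-null w w M eqw)) (sym (cross-null w f M eqw))))
  where
  lem : ∀ x → 0ℤ ≡ 0ℤ - 0ℤ - 0ℤ * x
  lem = solve-∀
... | suc W | zero with trans (sym eqw) (total-≪ w f w≪f eqf)
...   | ()
gibbs w f w≪f | W@(suc _) | T@(suc _) = Pos-cancel-* (0<+ T) (Pos-cong (λ M → trans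
    (cong₂ (λ x y → + T * (cross w w M - cross w f M + + x * (ln T M - ln W M)) - (+ T * + x - + W * + y) * 𝟙 M) eqw eqf)
    (lem (+ T) (+ W) (+ suc M) (cross w w M) (cross w f M) (ln T M) (ln W M))) (gibbs-sum W T w f w≪f))
  where
  lem : ∀ T W t a b x y → T * (a - b + W * (x - y)) - (T * W - W * T) * t ≡ T * (a - b - W * (y - x))
  lem = solve-∀

-- Concavity of the entropy in homogeneous form: Gibbs' inequality for v and for w, each against the
-- mixture. For unions it expresses that revealing the first coordinates of both sets, and not just
-- that of their union, cannot raise the remaining entropy.
Ent-+ : ∀ {n} (v w : Weight n) → Pos (λ M → Ent (v ⊎ʷ w) M - Ent v M - Ent w M)
Ent-+ v w = Pos-cong (λ M → trans (lem (+ total v) (+ total w) (ln (total v) M) (ln (total w) M) (ln (total f) M) (cross v v M) (cross w w M) (cross v f M) (cross w f M))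
    (cong₂ (λ x y → (+ x * ln (total f) M - y) - Ent v M - Ent w M) (sym (total-+ v w)) (sym (cross-+ v w f M))))
  (gibbs v f (λ S → ℕ.m+n≡0⇒m≡0 (v S)) ⊕ gibbs w f (λ S → ℕ.m+n≡0⇒n≡0 (v S)))
  where
  f = v ⊎ʷ w
  lem : ∀ V W lv lw l a b c d → (a - c - V * (lv - l)) + (b - d - W * (lw - l)) ≡ ((V + W) * l - (c + d)) - (V * lv - a) - (W * lw - b)
  lem = solve-∀

Ent-split : ∀ {n} (w : Weight (suc n)) M → Ent w M ≡ H (total (off w)) (total (on w)) M + Ent (off w) M + Ent (on w) M
Ent-split w M = lem (n-ln (total w) M) (n-ln (total (off w)) M) (n-ln (total (on w)) M) (cross (off w) (off w) M) (cross (on w) (on w) M)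
  where
  lem : ∀ t a b c d → t - (c + d) ≡ (t - a - b) + (a - c) + (b - d)
  lem = solve-∀

-- The union of two independent sets

infixl 7 _⋆_
-- Union convolution: f A · g B summed over all A ∪ B = S, that is, the law of A ∪ B for independent
-- A and B. The recursion follows the coordinates to match the chain rule.
_⋆_ : ∀ {n} → Weight n → Weight n → Weight n
(f ⋆ g) []            = f [] ℕ.* g []
(f ⋆ g) (outside ∷ S) = (off f ⋆ off g) S
(f ⋆ g) (inside ∷ S)  = ((off f ⋆ on g) ⊎ʷ (on f ⋆ off g) ⊎ʷ (on f ⋆ on g)) S

total-⋆ : ∀ {n} (f g : Weight n) → total (f ⋆ g) ≡ total f ℕ.* total g
total-⋆-on : ∀ {n} (f g : Weight (suc n)) →
  total (on (f ⋆ g)) ≡ total (off f) ℕ.* total (on g) ℕ.+ total (on f) ℕ.* total (off g) ℕ.+ total (on f) ℕ.* total (on g)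

total-⋆-on f g = trans (total-+ (off f ⋆ on g ⊎ʷ on f ⋆ off g) (on f ⋆ on g))
  (cong₂ ℕ._+_ (trans (total-+ (off f ⋆ on g) (on f ⋆ off g)) (cong₂ ℕ._+_ (total-⋆ (off f) (on g)) (total-⋆ (on f) (off g)))) (total-⋆ (on f) (on g)))
total-⋆ {zero} f g = refl
total-⋆ {suc n} f g = trans (cong₂ ℕ._+_ (total-⋆ (off f) (off g)) (total-⋆-on f g)) (lem (total (off f)) (total (on f)) (total (off g)) (total (on g)))
  where
  lem : ∀ a a′ b b′ → a ℕ.* b ℕ.+ (a ℕ.* b′ ℕ.+ a′ ℕ.* b ℕ.+ a′ ℕ.* b′) ≡ (a ℕ.+ a′) ℕ.* (b ℕ.+ b′)
  lem = ℕ-Ring.solve-∀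

⋆-≢0 : ∀ {n} (f g : Weight n) S → (f ⋆ g) S ≢ 0 → ∃₂ λ A B → f A ≢ 0 × g B ≢ 0 × A ∪ B ≡ S
⋆-≢0 f g [] ne = [] , [] , (λ eq → ne (cong (ℕ._* g []) eq)) , (λ eq → ne (trans (cong (f [] ℕ.*_) eq) (ℕ.*-zeroʳ (f [])))) , refl
⋆-≢0 f g (outside ∷ S) ne with ⋆-≢0 (off f) (off g) S ne
... | A , B , p , q , eq = outside ∷ A , outside ∷ B , p , q , cong (outside ∷_) eq
⋆-≢0 f g (inside ∷ S) ne with (off f ⋆ on g) S ℕ.≟ 0 | (on f ⋆ off g) S ℕ.≟ 0 | (on f ⋆ on g) S ℕ.≟ 0
... | no x | _ | _ with ⋆-≢0 (off f) (on g) S x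
...   | A , B , p , q , eq = outside ∷ A , inside ∷ B , p , q , cong (inside ∷_) eq
⋆-≢0 f g (inside ∷ S) ne | _ | no x | _ with ⋆-≢0 (on f) (off g) S x
...   | A , B , p , q , eq = inside ∷ A , outside ∷ B , p , q , cong (inside ∷_) eq
⋆-≢0 f g (inside ∷ S) ne | _ | _ | no x with ⋆-≢0 (on f) (on g) S x
...   | A , B , p , q , eq = inside ∷ A , inside ∷ B , p , q , cong (inside ∷_) eq
⋆-≢0 f g (inside ∷ S) ne | yes x | yes y | yes z = ⊥-elim (ne (cong₂ ℕ._+_ (cong₂ ℕ._+_ x y) z))

zeros : ∀ {n} → Weight n → Fin n → ℕ
zeros f zero    = total (off f)
zeros f (suc i) = zeros (off f) i ℕ.+ zeros (on f) i

-- Σᵢ z i · (total g · entropy of the i-th coordinate of g given the previous ones)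
weightedEnt : ∀ {n} → (Fin n → ℕ) → Weight n → ℕ → ℤ
weightedEnt {zero}  z g M = 0ℤ
weightedEnt {suc n} z g M = + z zero * H (total (off g)) (total (on g)) M + (weightedEnt (z ∘ suc) (off g) M + weightedEnt (z ∘ suc) (on g) M)

weightedEnt-+ : ∀ {n} (y z : Fin n → ℕ) (g : Weight n) M → weightedEnt (λ i → y i ℕ.+ z i) g M ≡ weightedEnt y g M + weightedEnt z g M
weightedEnt-+ {zero}  y z g M = refl
weightedEnt-+ {suc n} y z g M = trans (cong₂ (λ p q → + (y zero ℕ.+ z zero) * h + (p + q)) (weightedEnt-+ (y ∘ suc) (z ∘ suc) (off g) M) (weightedEnt-+ (y ∘ suc) (z ∘ suc) (on g) M))
  (lem (+ y zero) (+ z zero) h (weightedEnt (y ∘ suc) (off g) M) (weightedEnt (z ∘ suc) (off g) M) (weightedEnt (y ∘ suc) (on g) M) (weightedEnt (z ∘ suc) (on g) M))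
  where
  h = H (total (off g)) (total (on g)) M
  lem : ∀ y z h a b c d → (y + z) * h + ((a + b) + (c + d)) ≡ (y * h + (a + c)) + (z * h + (b + d))
  lem = solve-∀

-- By the chain rule a constant z would give X times the entropy; the conditional entropies are
-- nonnegative, so larger weights only help.
weightedEnt-≥ : ∀ {n} X (z : Fin n → ℕ) (g : Weight n) → (∀ i → X ℕ.≤ z i) → Pos (λ M → weightedEnt z g M - + X * Ent g M)
weightedEnt-≥ {zero} X z g h = Pos-nonneg λ M → ≤-reflexive (lem (+ X) (+ g []) (ln (g []) M))
  where
  lem : ∀ X g l → 0ℤ ≡ 0ℤ - X * (g * l - g * l)
  lem = solve-∀
weightedEnt-≥ {suc n} X z g h = Pos-cong (λ M → trans
    (lem (+ X) (+ z zero) (H (total (off g)) (total (on g)) M) (Ent (off g) M) (Ent (on g) M) (weightedEnt (z ∘ suc) (off g) M) (weightedEnt (z ∘ suc) (on g) M))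
    (cong (λ x → weightedEnt z g M - + X * x) (sym (Ent-split g M))))
  ( i≤j⇒0≤j-i (+≤+ (h zero)) ⊛ H-nonneg (total (off g)) (total (on g))
  ⊕ weightedEnt-≥ X (z ∘ suc) (off g) (h ∘ suc)
  ⊕ weightedEnt-≥ X (z ∘ suc) (on g) (h ∘ suc))
  where
  lem : ∀ X z h e e′ d d′ → (z - X) * h + (d - X * e) + (d′ - X * e′) ≡ z * h + (d + d′) - X * (h + e + e′)
  lem = solve-∀

module _ (P Q : ℕ) .{{_ : NonZero Q}} (κ≥0 : 0ℤ ℤ.≤ + P * + Q + + Q * + Q - + P * + P) (8P≤13Q : 8 ℕ.* P ℕ.≤ 13 ℕ.* Q) where

  -- Two weights are needed because the induction pairs `off f` with `on g`. The product inequality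
  -- handles the first coordinate, `Ent-+` merges the three pairs that put it into the union.
  -- Independence enters through additivity of `weightedEnt` in z: summing over the past of A turns
  -- its conditional probabilities of missing i into Pr[i ∉ A].
  Ent-⋆ : ∀ {n} (f g : Weight n) → Pos (λ M → + 2 * + Q * Ent (f ⋆ g) M - + P * (weightedEnt (zeros f) g M + weightedEnt (zeros g) f M))
  Ent-⋆ {zero} f g = Pos-nonneg λ M → ≤-reflexive (lem (+ P) (+ Q) (+ (f [] ℕ.* g [])) (ln (f [] ℕ.* g []) M))
    where
    lem : ∀ P Q x l → 0ℤ ≡ + 2 * Q * (x * l - x * l) - P * (0ℤ + 0ℤ)
    lem = solve-∀
  Ent-⋆ {suc n} f g = Pos-cong (λ M → trans
      (lem (+ P) (+ Q) (H t₀ t₁ M) (Ent (f₀ ⋆ g₀) M) (Ent (f₀ ⋆ g₁) M) (Ent (f₁ ⋆ g₀) M) (Ent (f₁ ⋆ g₁) M) (Ent (f₀ ⋆ g₁ ⊎ʷ f₁ ⋆ g₀) M) (Ent (on (f ⋆ g)) M)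
        (+ total f₀ * H (total g₀) (total g₁) M) (+ total g₀ * H (total f₀) (total f₁) M)
        (W f₀ g₀ M) (W f₀ g₁ M) (W f₁ g₀ M) (W f₁ g₁ M) (W g₀ f₀ M) (W g₀ f₁ M) (W g₁ f₀ M) (W g₁ f₁ M))
      (cong₂ (λ x y → + 2 * + Q * x - + P * y)
        (trans (cong (λ h → h + Ent (f₀ ⋆ g₀) M + Ent (on (f ⋆ g)) M) (cong₂ (λ x y → H x y M) (sym (total-⋆ f₀ g₀)) (sym (total-⋆-on f g)))) (sym (Ent-split (f ⋆ g) M)))
        (sym (cong₂ (λ x y → (+ total f₀ * H (total g₀) (total g₁) M + x) + (+ total g₀ * H (total f₀) (total f₁) M + y))
          (cong₂ _+_ (weightedEnt-+ (zeros f₀) (zeros f₁) g₀ M) (weightedEnt-+ (zeros f₀) (zeros f₁) g₁ M))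
          (cong₂ _+_ (weightedEnt-+ (zeros g₀) (zeros g₁) f₀ M) (weightedEnt-+ (zeros g₀) (zeros g₁) f₁ M))))))
    ( H-product-bound P Q κ≥0 8P≤13Q (total f₀) (total f₁) (total g₀) (total g₁)
    ⊕ Ent-⋆ f₀ g₀ ⊕ Ent-⋆ f₀ g₁ ⊕ Ent-⋆ f₁ g₀ ⊕ Ent-⋆ f₁ g₁
    ⊕ 0≤-* (0≤+ 2) (0≤+ Q) ⊛ (Ent-+ (f₀ ⋆ g₁) (f₁ ⋆ g₀) ⊕ Ent-+ (f₀ ⋆ g₁ ⊎ʷ f₁ ⋆ g₀) (f₁ ⋆ g₁)))
    where
    f₀ = off f
    f₁ = on f
    g₀ = off g
    g₁ = on g
    t₀ = total f₀ ℕ.* total g₀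
    t₁ = total f₀ ℕ.* total g₁ ℕ.+ total f₁ ℕ.* total g₀ ℕ.+ total f₁ ℕ.* total g₁
    W : Weight n → Weight n → ℕ → ℤ
    W f g = weightedEnt (zeros f) g
    lem : ∀ P Q h e₀₀ e₀₁ e₁₀ e₁₁ e e₁ x y a b c d a′ b′ c′ d′ →
      (+ 2 * Q * h - P * (x + y))
      + (+ 2 * Q * e₀₀ - P * (a + a′)) + (+ 2 * Q * e₀₁ - P * (b + c′)) + (+ 2 * Q * e₁₀ - P * (c + b′)) + (+ 2 * Q * e₁₁ - P * (d + d′))
      + + 2 * Q * ((e - e₀₁ - e₁₀) + (e₁ - e - e₁₁))
      ≡ + 2 * Q * (h + e₀₀ + e₁) - P * ((x + ((a + c) + (b + d))) + (y + ((a′ + c′) + (b′ + d′))))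
    lem = solve-∀

-- The uniform distribution on a union-closed family

cross-indicator : ∀ {n} (w f : Weight n) → (∀ S → f S ℕ.≤ 1) → ∀ M → cross w f M ≡ 0ℤ
cross-indicator {zero} w f f≤1 M with f [] | f≤1 []
... | 0 | _ = trans (cong (+ w [] *_) (ln-0 M)) (lem (+ w []))
  where
  lem : ∀ x → x * 0ℤ ≡ 0ℤ
  lem = solve-∀
... | 1 | _ = trans (cong (+ w [] *_) (ln-1 M)) (lem (+ w []))
  where
  lem : ∀ x → x * 0ℤ ≡ 0ℤ
  lem = solve-∀
... | suc (suc _) | s≤s ()
cross-indicator {suc n} w f f≤1 M = cong₂ _+_ (cross-indicator (off w) (off f) (f≤1 ∘ (outside ∷_)) M) (cross-indicator (on w) (on f) (f≤1 ∘ (inside ∷_)) M)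

module _ {n} (f : Weight n) (f≤1 : ∀ S → f S ℕ.≤ 1) (closed : ∀ A B → f A ≢ 0 → f B ≢ 0 → f (A ∪ B) ≢ 0) (2≤N : 2 ℕ.≤ total f) where

  private
    N = total f

    ⋆-≪ : f ⋆ f ≪ f
    ⋆-≪ S fS≡0 with (f ⋆ f) S ℕ.≟ 0
    ... | yes eq = eq
    ... | no ne with ⋆-≢0 f f S ne
    ...   | A , B , p , q , refl = ⊥-elim (closed A B p q fS≡0)

  -- Gibbs' inequality against the indicator `f`, whose logarithms vanish; closure under unions
  -- provides the support condition.
  Ent-union-≤ : Pos (λ M → + N * + N * ln N M - Ent (f ⋆ f) M)
  Ent-union-≤ = Pos-cong (λ M → trans (cong₂ (λ x y → cross (f ⋆ f) (f ⋆ f) M - x - + y * (ln y M - ln N M)) (cross-indicator (f ⋆ f) f f≤1 M) (total-⋆ f f))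
      (trans (trans (cong (λ x → cross (f ⋆ f) (f ⋆ f) M - 0ℤ - x * (ln (N ℕ.* N) M - ln N M)) (pos-* N N))
        (trans (lem (cross (f ⋆ f) (f ⋆ f) M) (+ N) (ln (N ℕ.* N) M) (ln N M)) (cong (λ x → + N * + N * ln N M - (x * ln (N ℕ.* N) M - cross (f ⋆ f) (f ⋆ f) M)) (sym (pos-* N N)))))
        (cong (λ x → + N * + N * ln N M - (n-ln x M - cross (f ⋆ f) (f ⋆ f) M)) (sym (total-⋆ f f)))))
    (gibbs (f ⋆ f) f ⋆-≪)
    where
    lem : ∀ c N l k → c - 0ℤ - N * N * (l - k) ≡ N * N * k - (N * N * l - c)
    lem = solve-∀

  -- With D = `weightedEnt (zeros f) f` one has 2 Q N² log N ≥ 2 Q Ent (f ⋆ f) ≥ 4 P D / 2 ≥ 2 P X N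
  -- log N, whereas P X - Q N = N X + X² - N² = k + 1 > 0. So log N ≤ 0, against log N ≥ log 2 ≥ 11
  -- / 16.
  few-zeros : ∀ X → (∀ i → X ℕ.≤ zeros f i) → ¬ (N ℕ.* N ℕ.< N ℕ.* X ℕ.+ X ℕ.* X)
  few-zeros X X≤zeros lt with ≤⇒∃ lt
  ... | k , eq = ¬Pos-𝟙 (Pos-cancel-* (0<-* (0<-* (0<+ 22) (0<+ N)) (0<+ (suc k)))
      (Pos-cong (λ M → combine M (eqℤ eq))
        ( 0≤+ 16 ⊛
          ( 0≤-* (0≤+ 2) (0≤+ Q) ⊛ Ent-union-≤
          ⊕ Ent-⋆ P Q (κ≥0 (eqℤ eq)) 8P≤13Q f f
          ⊕ 0≤-* (0≤+ 2) (0≤+ P) ⊛ weightedEnt-≥ X (zeros f) f X≤zeros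
          ⊕ 0≤-* (0≤-* (0≤+ 2) (0≤+ N)) (0≤+ (suc k)) ⊛ ln-mono 2 N 2≤N)
        ⊕ 0≤-* (0≤-* (0≤+ 2) (0≤+ N)) (0≤+ (suc k)) ⊛ 16ln2≥11)))
    where
    -- N / X < P / Q < φ, as t ↦ (2 t + 1) / (t + 1) moves every t < φ closer to its fixed point φ.
    P = 2 ℕ.* N ℕ.+ X
    Q = N ℕ.+ X
    instance
      N≢0 : NonZero N
      N≢0 = ℕ.>-nonZero (ℕ.<⇒≤ 2≤N)
      Q≢0 : NonZero Q
      Q≢0 = ℕ.>-nonZero (ℕ.<-≤-trans (ℕ.<⇒≤ 2≤N) (ℕ.m≤m+n N X))

    eqℤ : ∀ {k} → N ℕ.* X ℕ.+ X ℕ.* X ≡ suc (N ℕ.* N) ℕ.+ k → + N * + X + + X * + X ≡ 1ℤ + (+ N * + N + + k)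
    eqℤ {k} eq = trans (cong₂ _+_ (sym (pos-* N X)) (sym (pos-* X X))) (trans (cong +_ eq) (cong (λ x → 1ℤ + (x + + k)) (pos-* N N)))

    isolate : ∀ {x y c : ℤ} → x ≡ 1ℤ + (y + c) → c ≡ x - y - 1ℤ
    isolate {y = y} {c} refl = lem y c
      where
      lem : ∀ y c → c ≡ 1ℤ + (y + c) - y - 1ℤ
      lem = solve-∀

    P-ℤ : + P ≡ + 2 * + N + + X
    P-ℤ = cong (_+ + X) (pos-* 2 N)

    -- The form P Q + Q² - P² keeps its value under (N, X) ↦ (2 N + X, N + X), so here it is k + 1.
    κ≥0 : ∀ {k} → + N * + X + + X * + X ≡ 1ℤ + (+ N * + N + + k) → 0ℤ ℤ.≤ + P * + Q + + Q * + Q - + P * + P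
    κ≥0 {k} eq = subst (0ℤ ℤ.≤_) (trans (sym eq′) (cong (λ x → x * + Q + + Q * + Q - x * x) (sym P-ℤ))) (0≤+ (suc k))
      where
      lem : ∀ N X → (+ 2 * N + X) * (N + X) + (N + X) * (N + X) - (+ 2 * N + X) * (+ 2 * N + X) ≡ 1ℤ + (N * X + X * X - N * N - 1ℤ)
      lem = solve-∀
      eq′ : (+ 2 * + N + + X) * + Q + + Q * + Q - (+ 2 * + N + + X) * (+ 2 * + N + + X) ≡ 1ℤ + + k
      eq′ = trans (lem (+ N) (+ X)) (cong (λ x → 1ℤ + x) (sym (isolate eq)))

    -- N / X < φ < 5 / 3, and the increasing map t ↦ (2 t + 1) / (t + 1) takes 5 / 3 to 13 / 8.
    3N≤5X : 3 ℕ.* N ℕ.≤ 5 ℕ.* X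
    3N≤5X with ℕ.≤-total (3 ℕ.* N) (5 ℕ.* X)
    ... | inj₁ le = le
    ... | inj₂ ge = ⊥-elim (ℕ.<-irrefl refl (begin-strict
      25 ℕ.* (N ℕ.* N) <⟨ ℕ.*-monoʳ-< 25 lt ⟩
      25 ℕ.* (N ℕ.* X ℕ.+ X ℕ.* X) ≡⟨ lem₁ N X ⟩
      5 ℕ.* N ℕ.* (5 ℕ.* X) ℕ.+ 5 ℕ.* X ℕ.* (5 ℕ.* X) ≤⟨ ℕ.+-mono-≤ (ℕ.*-monoʳ-≤ (5 ℕ.* N) ge) (ℕ.*-mono-≤ ge ge) ⟩
      5 ℕ.* N ℕ.* (3 ℕ.* N) ℕ.+ 3 ℕ.* N ℕ.* (3 ℕ.* N) ≤⟨ ℕ.m≤m+n _ (N ℕ.* N) ⟩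
      5 ℕ.* N ℕ.* (3 ℕ.* N) ℕ.+ 3 ℕ.* N ℕ.* (3 ℕ.* N) ℕ.+ N ℕ.* N ≡⟨ lem₂ N ⟩
      25 ℕ.* (N ℕ.* N) ∎))
      where
      open ℕ.≤-Reasoning
      lem₁ : ∀ N X → 25 ℕ.* (N ℕ.* X ℕ.+ X ℕ.* X) ≡ 5 ℕ.* N ℕ.* (5 ℕ.* X) ℕ.+ 5 ℕ.* X ℕ.* (5 ℕ.* X)
      lem₁ = ℕ-Ring.solve-∀
      lem₂ : ∀ N → 5 ℕ.* N ℕ.* (3 ℕ.* N) ℕ.+ 3 ℕ.* N ℕ.* (3 ℕ.* N) ℕ.+ N ℕ.* N ≡ 25 ℕ.* (N ℕ.* N)
      lem₂ = ℕ-Ring.solve-∀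

    8P≤13Q : 8 ℕ.* P ℕ.≤ 13 ℕ.* Q
    8P≤13Q = begin
      8 ℕ.* P ≡⟨ lem₁ N X ⟩
      13 ℕ.* N ℕ.+ 8 ℕ.* X ℕ.+ 3 ℕ.* N ≤⟨ ℕ.+-monoʳ-≤ (13 ℕ.* N ℕ.+ 8 ℕ.* X) 3N≤5X ⟩
      13 ℕ.* N ℕ.+ 8 ℕ.* X ℕ.+ 5 ℕ.* X ≡⟨ lem₂ N X ⟩
      13 ℕ.* Q ∎
      where
      open ℕ.≤-Reasoning
      lem₁ : ∀ N X → 8 ℕ.* (2 ℕ.* N ℕ.+ X) ≡ 13 ℕ.* N ℕ.+ 8 ℕ.* X ℕ.+ 3 ℕ.* N
      lem₁ = ℕ-Ring.solve-∀
      lem₂ : ∀ N X → 13 ℕ.* N ℕ.+ 8 ℕ.* X ℕ.+ 5 ℕ.* X ≡ 13 ℕ.* (N ℕ.+ X)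
      lem₂ = ℕ-Ring.solve-∀

    D = weightedEnt (zeros f) f

    combine : ∀ {k} M → + N * + X + + X * + X ≡ 1ℤ + (+ N * + N + + k) →
      + 16 * (+ 2 * + Q * (+ N * + N * ln N M - Ent (f ⋆ f) M) + (+ 2 * + Q * Ent (f ⋆ f) M - + P * (D M + D M))
        + + 2 * + P * (D M - + X * Ent f M) + + 2 * + N * + suc k * (ln N M - ln 2 M))
      + + 2 * + N * + suc k * (+ 16 * ln 2 M - + 11 * 𝟙 M)
      ≡ + 22 * + N * + suc k * (- 𝟙 M)
    combine {k} M eq = trans (cong₂ (λ x y → expr x y (+ N * ln N M - cross f f M)) P-ℤ (isolate eq))
      (trans (cong (λ x → expr (+ 2 * + N + + X) c (+ N * ln N M - x)) (cross-indicator f f f≤1 M))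
      (trans (lem (+ N) (+ X) (ln N M) (Ent (f ⋆ f) M) (D M) (ln 2 M) (+ suc M)) (cong (λ x → + 22 * + N * (1ℤ + x) * (- 𝟙 M)) (sym (isolate eq)))))
      where
      c = + N * + X + + X * + X - + N * + N - 1ℤ
      expr : ℤ → ℤ → ℤ → ℤ
      expr P k h = + 16 * (+ 2 * + Q * (+ N * + N * ln N M - Ent (f ⋆ f) M) + (+ 2 * + Q * Ent (f ⋆ f) M - P * (D M + D M))
        + + 2 * P * (D M - + X * h) + + 2 * + N * (1ℤ + k) * (ln N M - ln 2 M))
        + + 2 * + N * (1ℤ + k) * (+ 16 * ln 2 M - + 11 * 𝟙 M)
      lem : ∀ N X l E D l₂ t → let P = + 2 * N + X ; Q = N + X ; k = N * X + X * X - N * N - 1ℤ in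
        + 16 * (+ 2 * Q * (N * N * l - E) + (+ 2 * Q * E - P * (D + D)) + + 2 * P * (D - X * (N * l - 0ℤ)) + + 2 * N * (1ℤ + k) * (l - l₂))
        + + 2 * N * (1ℤ + k) * (+ 16 * l₂ - + 11 * t)
        ≡ + 22 * N * (1ℤ + k) * (- t)
      lem = solve-∀

-- Families as weights

null : ∀ {n} → Weight n
null _ = 0

total-null : ∀ n → total (null {n}) ≡ 0
total-null zero    = refl
total-null (suc n) = cong₂ ℕ._+_ (total-null n) (total-null n)

zeros-null : ∀ {n} (i : Fin n) → zeros null i ≡ 0
zeros-null {suc n} zero = total-null n
zeros-null (suc i)      = cong₂ ℕ._+_ (zeros-null i) (zeros-null i)

zeros-+ : ∀ {n} (v w : Weight n) i → zeros (v ⊎ʷ w) i ≡ zeros v i ℕ.+ zeros w i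
zeros-+ v w zero = total-+ (off v) (off w)
zeros-+ v w (suc i) = trans (cong₂ ℕ._+_ (zeros-+ (off v) (off w) i) (zeros-+ (on v) (on w) i))
  (lem (zeros (off v) i) (zeros (off w) i) (zeros (on v) i) (zeros (on w) i))
  where
  lem : ∀ a b c d → a ℕ.+ b ℕ.+ (c ℕ.+ d) ≡ a ℕ.+ c ℕ.+ (b ℕ.+ d)
  lem = ℕ-Ring.solve-∀

δ : ∀ {n} → Subset n → Weight n
δ []            []            = 1
δ (outside ∷ T) (outside ∷ S) = δ T S
δ (outside ∷ T) (inside ∷ S)  = 0
δ (inside ∷ T)  (outside ∷ S) = 0
δ (inside ∷ T)  (inside ∷ S)  = δ T S

total-δ : ∀ {n} (T : Subset n) → total (δ T) ≡ 1
total-δ []            = refl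
total-δ {suc n} (outside ∷ T) = cong₂ ℕ._+_ (total-δ T) (total-null n)
total-δ {suc n} (inside ∷ T)  = cong₂ ℕ._+_ (total-null n) (total-δ T)

zeros-δ-∈ : ∀ {n} (T : Subset n) i → i ∈ˢ T → zeros (δ T) i ≡ 0
zeros-δ-∈ {suc n} (inside ∷ T) zero here = total-null n
zeros-δ-∈ (outside ∷ T) (suc i) (there p) = cong₂ ℕ._+_ (zeros-δ-∈ T i p) (zeros-null i)
zeros-δ-∈ (inside ∷ T)  (suc i) (there p) = cong₂ ℕ._+_ (zeros-null i) (zeros-δ-∈ T i p)

zeros-δ-∉ : ∀ {n} (T : Subset n) i → i ∉ˢ T → zeros (δ T) i ≡ 1
zeros-δ-∉ (outside ∷ T) zero p = total-δ T
zeros-δ-∉ (inside ∷ T)  zero p = ⊥-elim (p here)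
zeros-δ-∉ (outside ∷ T) (suc i) p = cong₂ ℕ._+_ (zeros-δ-∉ T i (p ∘ there)) (zeros-null i)
zeros-δ-∉ (inside ∷ T)  (suc i) p = cong₂ ℕ._+_ (zeros-null i) (zeros-δ-∉ T i (p ∘ there))

δ-refl : ∀ {n} (T : Subset n) → δ T T ≡ 1
δ-refl []            = refl
δ-refl (outside ∷ T) = δ-refl T
δ-refl (inside ∷ T)  = δ-refl T

δ-≢0 : ∀ {n} (T S : Subset n) → δ T S ≢ 0 → S ≡ T
δ-≢0 []            []            _ = refl
δ-≢0 (outside ∷ T) (outside ∷ S) p = cong (outside ∷_) (δ-≢0 T S p)
δ-≢0 (outside ∷ T) (inside ∷ S)  p = ⊥-elim (p refl)
δ-≢0 (inside ∷ T)  (outside ∷ S) p = ⊥-elim (p refl)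
δ-≢0 (inside ∷ T)  (inside ∷ S)  p = cong (inside ∷_) (δ-≢0 T S p)

multiplicity : ∀ {n} → Family n → Weight n
multiplicity []      = null
multiplicity (T ∷ F) = δ T ⊎ʷ multiplicity F

total-multiplicity : ∀ {n} (F : Family n) → total (multiplicity F) ≡ length F
total-multiplicity {n} [] = total-null n
total-multiplicity (T ∷ F) = trans (total-+ (δ T) (multiplicity F)) (cong₂ ℕ._+_ (total-δ T) (total-multiplicity F))

zeros-multiplicity : ∀ {n} (F : Family n) i → zeros (multiplicity F) i ℕ.+ count i F ≡ length F
zeros-multiplicity [] i = trans (ℕ.+-identityʳ _) (zeros-null i)
zeros-multiplicity (T ∷ F) i with i ∈? T
... | yes i∈T = trans (cong (ℕ._+ suc (count i F)) (trans (zeros-+ (δ T) (multiplicity F) i) (cong (ℕ._+ zeros (multiplicity F) i) (zeros-δ-∈ T i i∈T))))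
  (trans (ℕ.+-suc (zeros (multiplicity F) i) (count i F)) (cong suc (zeros-multiplicity F i)))
... | no i∉T = trans (cong (ℕ._+ count i F) (trans (zeros-+ (δ T) (multiplicity F) i) (cong (ℕ._+ zeros (multiplicity F) i) (zeros-δ-∉ T i i∉T))))
  (cong suc (zeros-multiplicity F i))

multiplicity-∈ : ∀ {n} (F : Family n) {S} → S ∈ F → multiplicity F S ≢ 0
multiplicity-∈ (T ∷ F) (here refl) eq with trans (sym (δ-refl T)) (ℕ.m+n≡0⇒m≡0 (δ T T) eq)
... | ()
multiplicity-∈ (T ∷ F) {S} (there p) eq = multiplicity-∈ F p (ℕ.m+n≡0⇒n≡0 (δ T S) eq)

multiplicity-≢0 : ∀ {n} (F : Family n) S → multiplicity F S ≢ 0 → S ∈ F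
multiplicity-≢0 [] S p = ⊥-elim (p refl)
multiplicity-≢0 (T ∷ F) S p with δ T S ℕ.≟ 0
... | yes eq = there (multiplicity-≢0 F S (λ eq′ → p (cong₂ ℕ._+_ eq eq′)))
... | no ne = here (δ-≢0 T S ne)

multiplicity-≤1 : ∀ {n} (F : Family n) → Unique F → ∀ S → multiplicity F S ≤ 1
multiplicity-≤1 [] _ S = z≤n
multiplicity-≤1 (T ∷ F) (T∉F ∷ unique) S with δ T S ℕ.≟ 0
... | yes eq = subst (λ x → x ℕ.+ multiplicity F S ≤ 1) (sym eq) (multiplicity-≤1 F unique S)
... | no ne with δ-≢0 T S ne
...   | refl with multiplicity F S ℕ.≟ 0
...     | yes eq = ℕ.≤-reflexive (cong₂ ℕ._+_ (δ-refl T) eq)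
...     | no ne′ = ⊥-elim (ListAll.lookup T∉F (multiplicity-≢0 F T ne′) refl)

-- From the least number of zeros to the golden fraction

minimum : ∀ {n} (R : ℕ → Set) {N} → R N → (z : Fin n → ℕ) → (∀ i → R (z i)) → ∃[ X ] (R X × (∀ i → X ≤ z i))
-- The recursion starts from a default that satisfies `R`; the theorem supplies |F|, for which the
-- condition is N² < 2 N².
minimum {zero}  R {N} r z h = N , r , λ ()
minimum {suc n} R r z h with minimum R r (z ∘ suc) (h ∘ suc)
... | X , rX , X≤ with ℕ.≤-total X (z zero)
...   | inj₁ le = X , rX , λ { zero → le ; (suc i) → X≤ i }
...   | inj₂ ge = z zero , h zero , λ { zero → ℕ.≤-refl ; (suc i) → ℕ.≤-trans ge (X≤ i) }

AtLeastGoldenFrac? : ∀ a b → Dec (AtLeastGoldenFrac a b)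
AtLeastGoldenFrac? a b = _ ℕ.≤? _

-- With z = N - c the difference 3 N - 2 c is N + 2 z, and (N + 2 z)² > 5 N² simplifies to z² + N z
-- > N².
¬AtLeastGoldenFrac : ∀ z c N → z ℕ.+ c ≡ N → ¬ AtLeastGoldenFrac c N → N ℕ.* N ℕ.< N ℕ.* z ℕ.+ z ℕ.* z
¬AtLeastGoldenFrac z c N eq ¬h = ℕ.*-cancelˡ-< 4 _ _ (ℕ.+-cancelˡ-< (N ℕ.* N) _ _ (begin-strict
  N ℕ.* N ℕ.+ 4 ℕ.* (N ℕ.* N) ≡⟨ lem₁ N ⟩
  5 ℕ.* N ℕ.^ 2 <⟨ ℕ.≰⇒> ¬h ⟩
  (3 ℕ.* N ℕ.∸ 2 ℕ.* c) ℕ.^ 2 ≡⟨ cong (ℕ._^ 2) (trans (cong (ℕ._∸ 2 ℕ.* c) 3N≡) (ℕ.m+n∸n≡m (N ℕ.+ 2 ℕ.* z) (2 ℕ.* c))) ⟩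
  (N ℕ.+ 2 ℕ.* z) ℕ.^ 2 ≡⟨ lem₂ N z ⟩
  N ℕ.* N ℕ.+ 4 ℕ.* (N ℕ.* z ℕ.+ z ℕ.* z) ∎))
  where
  open ℕ.≤-Reasoning
  lem₁ : ∀ N → N ℕ.* N ℕ.+ 4 ℕ.* (N ℕ.* N) ≡ 5 ℕ.* (N ℕ.* (N ℕ.* 1))
  lem₁ = ℕ-Ring.solve-∀
  lem₂ : ∀ N z → (N ℕ.+ 2 ℕ.* z) ℕ.* ((N ℕ.+ 2 ℕ.* z) ℕ.* 1) ≡ N ℕ.* N ℕ.+ 4 ℕ.* (N ℕ.* z ℕ.+ z ℕ.* z)
  lem₂ = ℕ-Ring.solve-∀
  lem₃ : ∀ z c → 3 ℕ.* (z ℕ.+ c) ≡ z ℕ.+ c ℕ.+ 2 ℕ.* z ℕ.+ 2 ℕ.* c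
  lem₃ = ℕ-Ring.solve-∀
  3N≡ : 3 ℕ.* N ≡ N ℕ.+ 2 ℕ.* z ℕ.+ 2 ℕ.* c
  3N≡ = subst (λ N → 3 ℕ.* N ≡ N ℕ.+ 2 ℕ.* z ℕ.+ 2 ℕ.* c) eq (lem₃ z c)

count-singleton : ∀ {n} (T : Subset n) i → i ∈ˢ T → count i (T ∷ []) ≡ 1
count-singleton T i i∈T with i ∈? T
... | yes _  = refl
... | no i∉T = ⊥-elim (i∉T i∈T)

theorem2 : (n : ℕ) → 1 ≤ n → (F : Family n) → Unique F → UnionClosed F →
    (∃[ S ] (S ∈ F × Nonempty S)) →
    ∃[ i ] AtLeastGoldenFrac (count i F) (length F)
-- A single set has entropy 0, so the entropy comparison yields no contradiction; any element of the
-- set has frequency 1.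
theorem2 n _ (T ∷ []) _ _ (S , here refl , i , i∈S) = i , subst (λ c → AtLeastGoldenFrac c 1) (sym (count-singleton S i i∈S)) (s≤s z≤n)
theorem2 n _ F@(_ ∷ _ ∷ _) unique closed _ with any? (λ i → AtLeastGoldenFrac? (count i F) (length F))
... | yes p = p
... | no ¬p = ⊥-elim (contra (minimum (λ X → N ℕ.* N ℕ.< N ℕ.* X ℕ.+ X ℕ.* X) {N} (ℕ.m<m+n (N ℕ.* N) (s≤s z≤n)) (zeros f)
    (λ i → ¬AtLeastGoldenFrac (zeros f i) (count i F) N (zeros-multiplicity F i) (λ h → ¬p (i , h)))))
  where
  f = multiplicity F
  N = length F
  N≡ = total-multiplicity F
  contra : ¬ (∃[ X ] (N ℕ.* N ℕ.< N ℕ.* X ℕ.+ X ℕ.* X × (∀ i → X ≤ zeros f i)))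
  contra (X , lt , X≤) = few-zeros f (multiplicity-≤1 F unique)
    (λ A B p q → multiplicity-∈ F (closed A B (multiplicity-≢0 F A p) (multiplicity-≢0 F B q)))
    (subst (2 ≤_) (sym N≡) (s≤s (s≤s z≤n))) X X≤ (subst (λ N → N ℕ.* N ℕ.< N ℕ.* X ℕ.+ X ℕ.* X) (sym N≡) lt)
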